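{- For every integer $h\geq 1$, there is a poset of height $h$ whose cover graph is planar and whose dimension is at least $2h-2$.
   Context: All posets are finite. The height of a poset is the maximum size of a chain in it. The dimension of a poset $P$ is the least integer $d$ such that $P$ is the intersection of $d$ linear orders. A cover relation of $P$ is a relation $a\leq b$ in $P$ with $a\neq b$ such that there is no element $c$ distinct from $a,b$ with $a\leq c\leq b$ in $P$. The cover graph of $P$ is the undirected graph whose vertices are the elements of $P$ and in which two elements are adjacent if they are in a cover relation in $P$. The planarity required here is planarity of the cover graph as an undirected graph (not of the upward-drawn diagram). -}

module Defs where

open import Level using (0ℓ)
open import Data.Nat.Base as ℕ using (ℕ)
open import Data.Fin.Base as Fin using (Fin)
open import Data.Fin.Subset using (Subset; _∈_; ∣_∣)
open import Data.Product using (Σ-syntax; ∃-syntax; _×_; _,_)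
open import Data.Rational.Base using (ℚ; 0ℚ; 1ℚ; _+_; _*_; _-_; _≤_)
open import Data.Sum using (_⊎_; inj₁; inj₂; swap)
open import Function.Bundles using (_⇔_)
open import Function.Definitions using (Injective)
open import Relation.Binary.Core using (Rel)
open import Relation.Binary.Definitions using (Symmetric; Irreflexive)
open import Relation.Binary.PropositionalEquality using (_≡_; _≢_; refl)
open import Relation.Binary.Structures using (IsDecPartialOrder; IsTotalOrder)
open import Relation.Nullary using (¬_)

record FinPoset : Set₁ where
  field
    size              : ℕ
    _⊑_               : Rel (Fin size) 0ℓ
    isDecPartialOrder : IsDecPartialOrder _≡_ _⊑_

record Graph (n : ℕ) : Set₁ where
  field
    Adj    : Rel (Fin n) 0ℓ
    symm   : Symmetric Adj
    irrefl : Irreflexive _≡_ Adj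

module _ (P : FinPoset) where
  open FinPoset P

  IsChain : Subset size → Set
  IsChain s = ∀ {x y} → x ∈ s → y ∈ s → x ⊑ y ⊎ y ⊑ x

  HasHeight : ℕ → Set
  HasHeight h = (∃[ s ] (IsChain s × ∣ s ∣ ≡ h))
              × (∀ s → IsChain s → ∣ s ∣ ℕ.≤ h)

  -- For d = 0 the intersection is the full relation on the ground set, so
  -- only posets with at most one element have dimension 0.
  IsIntersectionOfLinearOrders : ℕ → Set₁
  IsIntersectionOfLinearOrders d =
    Σ[ L ∈ (Fin d → Rel (Fin size) 0ℓ) ]
      ( (∀ i → IsTotalOrder _≡_ (L i))
      × (∀ x y → x ⊑ y ⇔ (∀ i → L i x y)) )

  HasDimension : ℕ → Set₁
  HasDimension d = IsIntersectionOfLinearOrders d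
                 × (∀ e → IsIntersectionOfLinearOrders e → d ℕ.≤ e)

  Cover : Rel (Fin size) 0ℓ
  Cover a b = a ⊑ b × a ≢ b × ¬ (∃[ c ] (c ≢ a × c ≢ b × a ⊑ c × c ⊑ b))

  coverGraph : Graph size
  coverGraph = record
    { Adj    = λ a b → Cover a b ⊎ Cover b a
    ; symm   = swap
    ; irrefl = λ { refl (inj₁ (_ , a≢a , _)) → a≢a refl
                 ; refl (inj₂ (_ , a≢a , _)) → a≢a refl }
    }

-- Plane graphs have polygonal arcs as edges.  Rational coordinates lose
-- nothing: the bends and vertices of a real polygonal drawing of a finite graph
-- can be perturbed to rational points, and two segments with rational endpoints
-- that meet in ℝ² meet in a rational point.
Point : Set
Point = ℚ × ℚ

OnSegment : Point → Point → Point → Set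
OnSegment (px , py) (qx , qy) r =
  ∃[ t ] ( 0ℚ ≤ t × t ≤ 1ℚ
         × r ≡ ((1ℚ - t) * px + t * qx , (1ℚ - t) * py + t * qy) )

data Polyline : Point → Point → Set where
  segment : ∀ p q → Polyline p q
  _▸_     : ∀ p {q r} → Polyline q r → Polyline p r

infixr 5 _▸_

OnPolyline : ∀ {p q} → Polyline p q → Point → Set
OnPolyline (segment p q)   x = OnSegment p q x
OnPolyline (_▸_ p {q} γ)   x = OnSegment p q x ⊎ OnPolyline γ x

-- A simple polyline is an arc, i.e. homeomorphic to [0,1].
Simple : ∀ {p q} → Polyline p q → Set
Simple (segment p q) = p ≢ q
Simple (_▸_ p {q} γ) =
  p ≢ q × (∀ x → OnSegment p q x → OnPolyline γ x → x ≡ q) × Simple γ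

record PlaneDrawing {n : ℕ} (G : Graph n) : Set where
  open Graph G

  -- Each undirected edge is represented once, by its endpoints in increasing
  -- index order.
  Edge : Fin n → Fin n → Set
  Edge u v = u Fin.< v × Adj u v

  field
    pos           : Fin n → Point
    pos-injective : Injective _≡_ _≡_ pos
    -- The values at pairs that are not edges are unconstrained.
    arc           : ∀ u v → Polyline (pos u) (pos v)
    arc-simple    : ∀ {u v} → Edge u v → Simple (arc u v)
    arc-vertices  : ∀ {u v} → Edge u v → ∀ w →
                    OnPolyline (arc u v) (pos w) → w ≡ u ⊎ w ≡ v
    arcs-meet     : ∀ {u v u′ v′} → Edge u v → Edge u′ v′ →
                    (u , v) ≢ (u′ , v′) → ∀ x →
                    OnPolyline (arc u v) x → OnPolyline (arc u′ v′) x →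
                    ∃[ w ] (x ≡ pos w)

Planar : ∀ {n} → Graph n → Set
Planar G = PlaneDrawing G

{-# OPTIONS --safe #-}

-- Arcs of a cycle of length N = r + 1, ordered by inclusion, contain a standard example: the
-- arc {i} lies in every arc of size r but the complement of i.  Their cover graph is a
-- lattice on a cylinder with the one-point arcs along one rim.  Take two copies, and put the
-- arc {0} of each copy above all other one-point arcs of the other.  Then every one-point arc
-- but {0} lies below all arcs containing 0 of the other copy, in particular below the
-- complements of the points other than 0, so that a standard example of size 2r results,
-- while the height grows only from r to r + 1.  The cover graph remains planar: glue the
-- rims of the cylinders along an annulus in which the two vertices {0} span disjoint fans.
module Submission where

open import Defs
open import Level using (0ℓ)
open import Data.Bool.Base using (true)
import Data.Bool.Properties as Bool
open import Data.Empty using (⊥; ⊥-elim)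
open import Data.Fin.Base as Fin using (Fin; zero; suc; toℕ; fromℕ<; combine; remQuot)
open import Data.Fin.Properties as Fin
  using (all?; any?; remQuot-combine; combine-remQuot; combine-monoˡ-<; toℕ-combine;
         toℕ<n; toℕ-injective; toℕ-fromℕ<; ¬∀⟶∃¬; injective⇒≤)
open import Data.Fin.Subset using (Subset; inside; outside; _∈_; ∣_∣)
open import Data.Fin.Subset.Properties using (anySubset?)
open import Data.List.Base using (List; []; _∷_; cartesianProduct; allFin)
import Data.List.Membership.Propositional as List
open import Data.List.Membership.Propositional.Properties using (∈-cartesianProduct⁺; ∈-allFin)
open import Data.List.Relation.Unary.Any using (here; there)
open import Data.Nat.Base as ℕ using (ℕ; zero; suc; z≤n; s≤s)
import Data.Nat.Properties as ℕ
open import Data.Product as Product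
  using (Σ-syntax; ∃-syntax; _×_; _,_; proj₁; proj₂; uncurry)
open import Data.Rational.Base using (ℚ; 0ℚ; 1ℚ)
open import Data.Sum as Sum using (_⊎_; inj₁; inj₂)
open import Data.Vec.Base as Vec using (lookup; tabulate)
open import Data.Vec.Properties using (lookup∘tabulate; []=⇒lookup; lookup⇒[]=)
open import Function.Base using (_∘_; id)
open import Function.Bundles using (_⇔_; mk⇔; Equivalence)
open import Function.Definitions using (Injective)
open import Relation.Binary.Core using (Rel; _⇒_)
open import Relation.Binary.Definitions
  using (Decidable; Antisymmetric; Transitive; tri<; tri≈; tri>)
open import Relation.Binary.PropositionalEquality
  using (_≡_; _≢_; refl; sym; trans; cong; cong₂; subst; subst₂; isEquivalence; module ≡-Reasoning)
open import Relation.Binary.Structures using (IsDecPartialOrder; IsTotalOrder)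
open import Relation.Nullary using (¬_; Dec; yes; no; contradiction; does)
open import Relation.Nullary.Decidable
  using (map′; _×-dec_; _⊎-dec_; _→-dec_; dec-true; dec⇒maybe)
import Relation.Unary as Unary
open import Tactic.RingSolver.Core.AlmostCommutativeRing
  using (AlmostCommutativeRing; fromCommutativeRing)

-- One copy alone has r + 1 pairs at height r; the second copy nearly doubles the pairs at the cost
-- of one level, which is the origin of the factor 2. The pairs of the point 0 are lost: the
-- complement of 0 lies above nothing of the other copy, and the two arcs {0} cannot both lie below
-- each other. This leaves 2(r + 1) - 2 = 2r = 2h - 2 pairs.
--
-- Two demands of the definitions shape the rest. `HasDimension` asks for the least number itself,
-- so a lower bound is not enough: some realiser has to be found, and the existence of one of a
-- given size has to be decidable. A `PlaneDrawing` asks for explicit polygonal arcs. So each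
-- cylinder is cut open between its last column and its first and laid out as an integer grid; the
-- edges across the cut are led around the grid. Coordinates are chosen so that every claim that two
-- curves are disjoint comes down to an inequality whose certificate is a ring identity.

private variable
  n : ℕ

-- Every finite poset has a dimension

-- `HasDimension` contains a minimality clause, so the minimum is found by search, which takes a
-- decidable property and one number that has it.
least : ∀ {p} {P : ℕ → Set p} → Unary.Decidable P → ∀ k → P k →
        ∃[ d ] (P d × (∀ e → P e → d ℕ.≤ e))
least P? zero    Pk = zero , Pk , λ _ _ → z≤n
least P? (suc k) Pk with P? zero
... | yes P0 = zero , P0 , λ _ _ → z≤n
... | no ¬P0 with d , Pd , d-least ← least (P? ∘ suc) k Pk =
  suc d , Pd , λ where
    zero    P0 → contradiction P0 ¬P0
    (suc e) Pe → s≤s (d-least e Pe)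

private variable
  Q L : Rel (Fin n) 0ℓ
  x y : Fin n

-- The least order containing Q in which y lies below x.
Adjoin : Rel (Fin n) 0ℓ → Fin n → Fin n → Rel (Fin n) 0ℓ
Adjoin Q x y u v = Q u v ⊎ (Q u y × Q x v)

adjoin : IsDecPartialOrder _≡_ Q → ¬ Q x y →
         IsDecPartialOrder _≡_ (Adjoin Q x y)
adjoin {Q = Q} {x = x} {y = y} po ¬xy = record
  { isPartialOrder = record
    { isPreorder = record
      { isEquivalence = isEquivalence
      ; reflexive     = inj₁ ∘ PO.reflexive
      ; trans         = trans′
      }
    ; antisym = antisym′
    }
  ; _≟_  = Fin._≟_
  ; _≤?_ = λ u v → (u PO.≤? v) ⊎-dec ((u PO.≤? y) ×-dec (x PO.≤? v))
  }
  where
  module PO = IsDecPartialOrder po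
  trans′ : Transitive (Adjoin Q x y)
  trans′ (inj₁ uv)        (inj₁ vw)        = inj₁ (PO.trans uv vw)
  trans′ (inj₁ uv)        (inj₂ (vy , xw)) = inj₂ (PO.trans uv vy , xw)
  trans′ (inj₂ (uy , xv)) (inj₁ vw)        = inj₂ (uy , PO.trans xv vw)
  trans′ (inj₂ (uy , xv)) (inj₂ (vy , xw)) = contradiction (PO.trans xv vy) ¬xy
  antisym′ : Antisymmetric _≡_ (Adjoin Q x y)
  antisym′ (inj₁ uv)        (inj₁ vu)        = PO.antisym uv vu
  antisym′ (inj₁ uv)        (inj₂ (vy , xu)) =
    contradiction (PO.trans (PO.trans xu uv) vy) ¬xy
  antisym′ (inj₂ (uy , xv)) (inj₁ vu)        =
    contradiction (PO.trans (PO.trans xv vu) uy) ¬xy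
  antisym′ (inj₂ (uy , xv)) (inj₂ (vy , xu)) = contradiction (PO.trans xv vy) ¬xy

-- Szpilrajn's extension, pair by pair. A settled pair stays settled because the order only grows;
-- decidability is carried along because each pair is settled by asking whether `x` already lies
-- below `y`.
extendOn : (ps : List (Fin n × Fin n)) → IsDecPartialOrder _≡_ Q →
           Σ[ L ∈ Rel (Fin n) 0ℓ ] (IsDecPartialOrder _≡_ L × (Q ⇒ L) ×
             (∀ {u v} → (u , v) List.∈ ps → L u v ⊎ L v u))
extendOn {Q = Q} []             po = Q , po , id , λ ()
extendOn {Q = Q} ((x , y) ∷ ps) po with IsDecPartialOrder._≤?_ po x y
... | yes xy with L , po′ , Q⇒L , tot ← extendOn ps po =
  L , po′ , Q⇒L , λ where
    (here refl) → inj₁ (Q⇒L xy)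
    (there uv∈) → tot uv∈
... | no ¬xy with L , po′ , Q⇒L , tot ← extendOn ps (adjoin po ¬xy) =
  L , po′ , Q⇒L ∘ inj₁ , λ where
    (here refl) → inj₂ (Q⇒L (inj₂ (PO.refl , PO.refl)))
    (there uv∈) → tot uv∈
  where module PO = IsDecPartialOrder po

linearExtension : IsDecPartialOrder _≡_ Q →
                  Σ[ L ∈ Rel (Fin n) 0ℓ ] (IsTotalOrder _≡_ L × (Q ⇒ L))
linearExtension {n = n} po
  with L , po′ , Q⇒L , tot ← extendOn (cartesianProduct (allFin n) (allFin n)) po =
  L , record
    { isPartialOrder = IsDecPartialOrder.isPartialOrder po′
    ; total = λ u v → tot (∈-cartesianProduct⁺ (∈-allFin u) (∈-allFin v))
    } , Q⇒L

-- If totality answers with `L v u`, antisymmetry leaves equality as the only way for `L u v` to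
-- hold. This is what turns the arbitrary relations of a realiser into tables of booleans.
total⇒decidable : IsTotalOrder _≡_ L → Decidable L
total⇒decidable to u v with IsTotalOrder.total to u v
... | inj₁ uv = yes uv
... | inj₂ vu with u Fin.≟ v
...   | yes u≡v = yes (IsTotalOrder.reflexive to u≡v)
...   | no  u≢v = no λ uv → u≢v (IsTotalOrder.antisym to uv vu)

total-resp : (∀ u v → L u v ⇔ Q u v) → IsTotalOrder _≡_ L → IsTotalOrder _≡_ Q
total-resp {L = L} {Q = Q} eq to = record
  { isPartialOrder = record
    { isPreorder = record
      { isEquivalence = isEquivalence
      ; reflexive     = to′ ∘ TO.reflexive
      ; trans         = λ uv vw → to′ (TO.trans (from′ uv) (from′ vw))
      }
    ; antisym = λ uv vu → TO.antisym (from′ uv) (from′ vu)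
    }
  ; total = λ u v → Sum.map to′ to′ (TO.total u v)
  }
  where
  module TO = IsTotalOrder to
  to′ : L ⇒ Q
  to′ = Equivalence.to (eq _ _)
  from′ : Q ⇒ L
  from′ = Equivalence.from (eq _ _)

isTotalOrder? : Decidable L → Dec (IsTotalOrder _≡_ L)
isTotalOrder? {L = L} L? = map′
  (λ (r , t , a , c) → record
    { isPartialOrder = record
      { isPreorder = record
        { isEquivalence = isEquivalence
        ; reflexive     = λ { {u} refl → r u }
        ; trans         = λ {u} {v} {w} → t u v w
        }
      ; antisym = λ {u} {v} → a u v
      }
    ; total = c
    })
  (λ to → let module TO = IsTotalOrder to in
    (λ _ → TO.refl) , (λ _ _ _ → TO.trans) , (λ _ _ → TO.antisym) , TO.total)
  (all? (λ u → L? u u) ×-dec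
   all? (λ u → all? λ v → all? λ w → L? u v →-dec (L? v w →-dec L? u w)) ×-dec
   all? (λ u → all? λ v → L? u v →-dec (L? v u →-dec (u Fin.≟ v))) ×-dec
   all? (λ u → all? λ v → L? u v ⊎-dec L? v u))

module Dimension (P : FinPoset) where
  open FinPoset P
  private module PO = IsDecPartialOrder isDecPartialOrder

  private
    -- A family of `d` relations as one table, with a bit for each order and two elements. There are
    -- finitely many tables, so `anySubset?` can search them for a realiser.
    Code : ℕ → Set
    Code d = Subset (d ℕ.* (size ℕ.* size))

    decode : ∀ d → Code d → Fin d → Rel (Fin size) 0ℓ
    decode d c i x y = lookup c (combine i (combine x y)) ≡ true

    decode? : ∀ d (c : Code d) i → Decidable (decode d c i)
    decode? d c i x y = lookup c (combine i (combine x y)) Bool.≟ true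

    index : ∀ {d} → Fin (d ℕ.* (size ℕ.* size)) → Fin d × Fin size × Fin size
    index {d} = Product.map₂ (remQuot {size} size) ∘ remQuot {d} (size ℕ.* size)

    index-combine : ∀ {d} (i : Fin d) x y → index (combine i (combine x y)) ≡ (i , x , y)
    index-combine i x y = trans
      (cong (Product.map₂ (remQuot {size} size)) (remQuot-combine i (combine x y)))
      (cong (i ,_) (remQuot-combine x y))

    encode : ∀ {d} {L : Fin d → Rel (Fin size) 0ℓ} → (∀ i → Decidable (L i)) → Code d
    encode L? = tabulate λ j → let i , x , y = index j in does (L? i x y)

    lookup-encode : ∀ {d} {L : Fin d → Rel (Fin size) 0ℓ} (L? : ∀ i → Decidable (L i)) →
                    ∀ i x y → lookup (encode L?) (combine i (combine x y)) ≡ does (L? i x y)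
    lookup-encode L? i x y = trans
      (lookup∘tabulate (λ j → let i , x , y = index j in does (L? i x y)) _)
      (cong (λ (i , x , y) → does (L? i x y)) (index-combine i x y))

    decode-encode : ∀ d {L : Fin d → Rel (Fin size) 0ℓ} (L? : ∀ i → Decidable (L i)) →
                    ∀ i x y → L i x y ⇔ decode d (encode L?) i x y
    decode-encode d L? i x y rewrite lookup-encode L? i x y with L? i x y
    ... | yes l = mk⇔ (λ _ → refl) (λ _ → l)
    ... | no ¬l = mk⇔ (λ l → contradiction l ¬l) (λ ())

    Realises : ∀ {d} → (Fin d → Rel (Fin size) 0ℓ) → Set
    Realises L = (∀ i → IsTotalOrder _≡_ (L i)) × (∀ x y → x ⊑ y ⇔ (∀ i → L i x y))

    ⇔-dec : ∀ {a b} {A : Set a} {B : Set b} → Dec A → Dec B → Dec (A ⇔ B)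
    ⇔-dec A? B? = map′ (λ (f , g) → mk⇔ f g) (λ e → Equivalence.to e , Equivalence.from e)
                       ((A? →-dec B?) ×-dec (B? →-dec A?))

  intersection? : ∀ d → Dec (IsIntersectionOfLinearOrders P d)
  intersection? d = map′
    (λ (c , r) → decode d c , r)
    (λ (L , to , int) →
      let L? = λ i → total⇒decidable (to i)
          eq = decode-encode d L?
      in encode L?
       , (λ i → total-resp (eq i) (to i))
       , λ x y → mk⇔
           (λ xy i → Equivalence.to (eq i x y) (Equivalence.to (int x y) xy i))
           (λ all → Equivalence.from (int x y) λ i → Equivalence.from (eq i x y) (all i)))
    (anySubset? {P = Realises ∘ decode d} λ c →
      all? (λ i → isTotalOrder? (decode? d c i)) ×-dec
      all? (λ x → all? λ y → ⇔-dec (x PO.≤? y) (all? λ i → decode? d c i x y)))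

  private
    -- If `x` is not below `y`, then `y` is put below `x` before extending. One such order for each
    -- ordered pair gives a realiser, where the search for the least one starts.
    separating : ∀ x y → Σ[ L ∈ Rel (Fin size) 0ℓ ]
                   (IsTotalOrder _≡_ L × (_⊑_ ⇒ L) × (L x y → x ⊑ y))
    separating x y with x PO.≤? y
    ... | yes xy with L , to , ⊑⇒L ← linearExtension isDecPartialOrder =
      L , to , ⊑⇒L , λ _ → xy
    ... | no ¬xy with L , to , ⊑⇒L ← linearExtension (adjoin isDecPartialOrder ¬xy) =
      L , to , ⊑⇒L ∘ inj₁ , λ Lxy →
        PO.reflexive (IsTotalOrder.antisym to Lxy (⊑⇒L (inj₂ (PO.refl , PO.refl))))

  intersection : IsIntersectionOfLinearOrders P (size ℕ.* size)
  intersection = proj₁ ∘ sep , proj₁ ∘ proj₂ ∘ sep , λ x y → mk⇔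
    (λ xy i → proj₁ (proj₂ (proj₂ (sep i))) xy)
    (λ all → proj₂ (proj₂ (proj₂ (separating x y)))
      (subst (λ (u , v) → proj₁ (separating u v) x y) (remQuot-combine x y)
        (all (combine x y))))
    where
    sep : ∀ i → _
    sep i = let x , y = remQuot {size} size i in separating x y

  hasDimension : ∃[ d ] HasDimension P d
  hasDimension = least intersection? _ intersection

  -- In a linear order that reverses two of the pairs, the b's and a's of these pairs
  -- would form a cycle.
  standardExample⇒≤ : ∀ {k e} (a b : Fin k → Fin size) →
    (∀ {i j} → i ≢ j → a i ⊑ b j) → (∀ i → ¬ a i ⊑ b i) →
    IsIntersectionOfLinearOrders P e → k ℕ.≤ e
  standardExample⇒≤ {k} {e} a b below apart (L , to , int) = injective⇒≤ injective
    where
    module TO i = IsTotalOrder (to i)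
    reversed : ∀ j → ∃[ i ] ¬ L i (a j) (b j)
    reversed j = ¬∀⟶∃¬ e (λ i → L i (a j) (b j)) (λ i → total⇒decidable (to i) _ _)
                   (apart j ∘ Equivalence.from (int _ _))
    injective : ∀ {j j′} → proj₁ (reversed j) ≡ proj₁ (reversed j′) → j ≡ j′
    injective {j} {j′} eq with j Fin.≟ j′
    ... | yes j≡j′ = j≡j′
    ... | no  j≢j′ = contradiction ajbj (proj₂ (reversed j))
      where
      i = proj₁ (reversed j)
      i′ = proj₁ (reversed j′)
      bj′aj′ : L i (b j′) (a j′)
      bj′aj′ with TO.total i (b j′) (a j′)
      ... | inj₁ p = p
      ... | inj₂ p = contradiction (subst (λ i → L i (a j′) (b j′)) eq p) (proj₂ (reversed j′))
      ajbj : L i (a j) (b j)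
      ajbj = TO.trans i (Equivalence.to (int _ _) (below j≢j′) i)
               (TO.trans i bj′aj′ (Equivalence.to (int _ _) (below (j≢j′ ∘ sym)) i))

-- Heights

-- `member` and `position` identify `Fin ∣ s ∣` with the elements of `s`, so that bounds on
-- cardinalities become injections between `Fin` types.
member : (s : Subset n) → Fin ∣ s ∣ → Fin n
member (inside  Vec.∷ s) zero    = zero
member (inside  Vec.∷ s) (suc i) = suc (member s i)
member (outside Vec.∷ s) i       = suc (member s i)

member-∈ : ∀ (s : Subset n) i → member s i ∈ s
member-∈ (inside  Vec.∷ s) zero    = Vec.here
member-∈ (inside  Vec.∷ s) (suc i) = Vec.there (member-∈ s i)
member-∈ (outside Vec.∷ s) i       = Vec.there (member-∈ s i)

member-injective : (s : Subset n) → Injective _≡_ _≡_ (member s)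
member-injective (inside  Vec.∷ s) {zero}  {zero}  _  = refl
member-injective (inside  Vec.∷ s) {suc i} {suc j} eq =
  cong suc (member-injective s (Fin.suc-injective eq))
member-injective (outside Vec.∷ s) eq = member-injective s (Fin.suc-injective eq)

position : ∀ {s : Subset n} {x} → x ∈ s → Fin ∣ s ∣
position {s = inside  Vec.∷ s} Vec.here        = zero
position {s = inside  Vec.∷ s} (Vec.there x∈s) = suc (position x∈s)
position {s = outside Vec.∷ s} (Vec.there x∈s) = position x∈s

member-position : ∀ {s : Subset n} {x} (x∈s : x ∈ s) → member s (position x∈s) ≡ x
member-position {s = inside  Vec.∷ s} Vec.here        = refl
member-position {s = inside  Vec.∷ s} (Vec.there x∈s) = cong suc (member-position x∈s)
member-position {s = outside Vec.∷ s} (Vec.there x∈s) = cong suc (member-position x∈s)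

image : ∀ {m} → (Fin m → Fin n) → Subset n
image f = tabulate λ x → does (any? λ i → f i Fin.≟ x)

∈-image⁺ : ∀ {m} (f : Fin m → Fin n) i → f i ∈ image f
∈-image⁺ f i = lookup⇒[]= (f i) _ (trans
  (lookup∘tabulate (λ x → does (any? λ i → f i Fin.≟ x)) (f i))
  (dec-true (any? λ j → f j Fin.≟ f i) (i , refl)))

∈-image⁻ : ∀ {m} (f : Fin m → Fin n) {x} → x ∈ image f → ∃[ i ] f i ≡ x
∈-image⁻ f {x} x∈ with any? (λ i → f i Fin.≟ x)
                     | trans (sym (lookup∘tabulate (λ x → does (any? λ i → f i Fin.≟ x)) x)) ([]=⇒lookup x∈)
... | yes p | _ = p
... | no  _ | ()

module _ (P : FinPoset) where
  open FinPoset P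

  -- The rank is injective on every chain, so none has more than `h` elements; the given `chain`
  -- attains this.
  hasHeight : ∀ {h} (rank : Fin size → Fin h) →
    (∀ {x y} → x ⊑ y → rank x ≡ rank y → x ≡ y) →
    (chain : Fin h → Fin size) → Injective _≡_ _≡_ chain →
    (∀ {i j} → i Fin.≤ j → chain i ⊑ chain j) →
    HasHeight P h
  hasHeight {h} rank strict chain inj mono =
    (image chain , isChain , ℕ.≤-antisym (bound _ isChain) (injective⇒≤ position-inj)) , bound
    where
    isChain : IsChain P (image chain)
    isChain x∈ y∈ with ∈-image⁻ chain x∈ | ∈-image⁻ chain y∈
    ... | i , refl | j , refl with Fin.≤-total i j
    ...   | inj₁ i≤j = inj₁ (mono i≤j)
    ...   | inj₂ j≤i = inj₂ (mono j≤i)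
    position-inj : Injective _≡_ _≡_ (position ∘ ∈-image⁺ chain)
    position-inj {i} {j} eq = inj (trans (sym (member-position (∈-image⁺ chain i)))
      (trans (cong (member (image chain)) eq) (member-position (∈-image⁺ chain j))))
    bound : ∀ s → IsChain P s → ∣ s ∣ ℕ.≤ h
    bound s ch = injective⇒≤ {f = rank ∘ member s} λ {i} {j} eq → member-injective s
      (case eq (ch (member-∈ s i) (member-∈ s j)))
      where
      case : ∀ {x y} → rank x ≡ rank y → x ⊑ y ⊎ y ⊑ x → x ≡ y
      case eq (inj₁ x⊑y) = strict x⊑y eq
      case eq (inj₂ y⊑x) = sym (strict y⊑x (sym eq))

-- Arcs of a cycle

module Arcs (r : ℕ) where
  open import Data.Nat.Base using (_+_; _*_; _≤_; _<_)
  open import Data.Nat.Tactic.RingSolver using (solve-∀)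

  -- Linear arithmetic without subtraction: the slack `e` is supplied by hand and the equation is
  -- left to the ring solver.
  lin : ∀ {a b c d} e → a ≤ b → c + b + e ≡ d + a → c ≤ d
  lin {a} {b} {c} {d} e a≤b eq = ℕ.+-cancelʳ-≤ a c d (begin
    c + a     ≤⟨ ℕ.+-monoʳ-≤ c a≤b ⟩
    c + b     ≤⟨ ℕ.m≤m+n (c + b) e ⟩
    c + b + e ≡⟨ eq ⟩
    d + a     ∎)
    where open ℕ.≤-Reasoning

  N : ℕ
  N = suc r

  -- The index is lexicographic in `s`, then `k`, then the copy. Covers thereby increase the index
  -- (`step⇒<`), and since the drawing lists an edge by increasing index, every edge it meets points
  -- upwards in the order.
  size : ℕ
  size = r * (N * 2)

  private
    height′ : Fin size → Fin r
    height′ u = proj₁ (remQuot {r} (N * 2) u)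
    column′ : Fin size → Fin N
    column′ u = proj₁ (remQuot {N} 2 (proj₂ (remQuot {r} (N * 2) u)))

  copy : Fin size → Fin 2
  copy u = proj₂ (remQuot {N} 2 (proj₂ (remQuot {r} (N * 2) u)))

  k s t : Fin size → ℕ
  k u = toℕ (column′ u)
  s u = toℕ (height′ u)
  t u = s u + k u

  k≤r : ∀ u → k u ≤ r
  k≤r u = ℕ.≤-pred (toℕ<n (column′ u))

  s<r : ∀ u → s u < r
  s<r u = toℕ<n (height′ u)

  private
    index : ∀ u → u ≡ combine (height′ u) (combine (column′ u) (copy u))
    index u = trans (sym (combine-remQuot {r} (N * 2) u))
      (cong (combine (height′ u)) (sym (combine-remQuot {N} 2 (proj₂ (remQuot {r} (N * 2) u)))))

  ext : ∀ {u v} → copy u ≡ copy v → k u ≡ k v → s u ≡ s v → u ≡ v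
  ext {u} {v} c≡ k≡ s≡ = begin
    u                                                   ≡⟨ index u ⟩
    combine (height′ u) (combine (column′ u) (copy u))  ≡⟨ cong₂ combine (toℕ-injective s≡)
                                                             (cong₂ combine (toℕ-injective k≡) c≡) ⟩
    combine (height′ v) (combine (column′ v) (copy v))  ≡⟨ index v ⟨
    v                                                   ∎
    where open ≡-Reasoning

  s<⇒< : ∀ {u v} → s u < s v → u Fin.< v
  s<⇒< {u} {v} lt = subst₂ Fin._<_ (sym (index u)) (sym (index v))
    (combine-monoˡ-< {i = height′ u} {j = height′ v} _ _ lt)

  k<⇒< : ∀ {u v} → s u ≡ s v → k u < k v → u Fin.< v
  k<⇒< {u} {v} s≡ lt = subst₂ _<_ (eq u)
    (trans (cong (λ i → N * 2 * i + toℕ (combine (column′ v) (copy v))) s≡) (eq v))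
    (ℕ.+-monoʳ-< (N * 2 * s u) (combine-monoˡ-< {i = column′ u} {j = column′ v} _ _ lt))
    where
    eq : ∀ u → N * 2 * s u + toℕ (combine (column′ u) (copy u)) ≡ toℕ u
    eq u = trans (sym (toℕ-combine (height′ u) (combine (column′ u) (copy u))))
      (cong toℕ (sym (index u)))

  record Element (c : Fin 2) (i j : ℕ) : Set where
    constructor element
    field
      this : Fin size
      copy≡ : copy this ≡ c
      k≡ : k this ≡ i
      s≡ : s this ≡ j

  abstract
    at : ∀ c {i j} → i ≤ r → j < r → Element c i j
    at c i≤r j<r = record
      { this  = combine j′ (combine i′ c)
      ; copy≡ = cong proj₂ column-copy
      ; k≡    = trans (cong (toℕ ∘ proj₁) column-copy) (toℕ-fromℕ< (s≤s i≤r))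
      ; s≡    = trans (cong (toℕ ∘ proj₁) (remQuot-combine j′ (combine i′ c))) (toℕ-fromℕ< j<r)
      }
      where
      i′ : Fin N
      i′ = fromℕ< (s≤s i≤r)
      j′ : Fin r
      j′ = fromℕ< j<r
      column-copy : remQuot {N} 2 (proj₂ (remQuot {r} (N * 2) (combine j′ (combine i′ c)))) ≡ (i′ , c)
      column-copy = trans (cong (remQuot {N} 2 ∘ proj₂) (remQuot-combine j′ (combine i′ c)))
                          (remQuot-combine i′ c)

  -- u stands for the arc of ℤ/N with points r - k - s, …, r - k.  Lifted to the line, the pairs
  -- (- k, t) are compared componentwise, and `around` compares with the next lift of v.
  data Inside (u v : Fin size) : Set where
    direct : k v ≤ k u → t u ≤ t v → Inside u v
    around : t u + N ≤ t v → Inside u v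

  -- The arc {0} has k = r and s = 0, and an arc contains the point 0 iff r ≤ t.
  infix 4 _⊑_
  data _⊑_ (u v : Fin size) : Set where
    inside : copy u ≡ copy v → Inside u v → u ⊑ v
    across : copy u ≢ copy v → s u ≡ 0 → k u < r → r ≤ t v → u ⊑ v

  inside-t : ∀ {u v} → Inside u v → t u ≤ t v
  inside-t (direct _ t≤) = t≤
  inside-t {u} (around t≤) = ℕ.≤-trans (ℕ.m≤m+n (t u) N) t≤

  -- Since k v ≤ r < N, the excess of N in `t` cannot come from `k` alone.
  wrap-s : ∀ {u v} → t u + N ≤ t v → s u < s v
  wrap-s {u} {v} t≤ = lin (k u) (ℕ.+-mono-≤ t≤ (k≤r v)) (lemma (s u) (k u) (s v) (k v) r)
    where
    lemma : ∀ s k s′ k′ r → suc s + (s′ + k′ + r) + k ≡ s′ + (s + k + suc r + k′)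
    lemma = solve-∀

  inside-s : ∀ {u v} → Inside u v → s u ≤ s v
  inside-s {u} {v} (direct k≤ t≤) = lin 0 (ℕ.+-mono-≤ k≤ t≤) (lemma (s u) (k u) (s v) (k v))
    where
    lemma : ∀ s k s′ k′ → s + (k + (s′ + k′)) + 0 ≡ s′ + (k′ + (s + k))
    lemma = solve-∀
  inside-s {u} {v} (around t≤) = ℕ.<⇒≤ (wrap-s {u} {v} t≤)

  inside-same-s : ∀ {u v} → copy u ≡ copy v → Inside u v → s u ≡ s v → u ≡ v
  inside-same-s {u} {v} c≡ (direct k≤ t≤) s≡ = ext c≡
    (ℕ.≤-antisym (ℕ.+-cancelˡ-≤ (s u) (k u) (k v) (subst (λ x → t u ≤ x + k v) (sym s≡) t≤)) k≤) s≡
  inside-same-s {u} {v} c≡ (around t≤) s≡ = contradiction s≡ (ℕ.<⇒≢ (wrap-s {u} {v} t≤))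

  inside-trans : Transitive Inside
  inside-trans (direct k≤ t≤) (direct k≤′ t≤′) = direct (ℕ.≤-trans k≤′ k≤) (ℕ.≤-trans t≤ t≤′)
  inside-trans (direct _ t≤)  (around t≤′)     = around (ℕ.≤-trans (ℕ.+-monoˡ-≤ N t≤) t≤′)
  inside-trans (around t≤)    vw               = around (ℕ.≤-trans t≤ (inside-t vw))

  singleton-t< : ∀ {u} → s u ≡ 0 → k u < r → ¬ r ≤ t u
  singleton-t< {u} su≡0 ku<r r≤tu = ℕ.<⇒≱ ku<r (subst (λ x → r ≤ x + k u) su≡0 r≤tu)

  -- An arc inside a one-point arc equals it, which settles `inside` followed by `across`. Two uses
  -- of `across` never compose: the target of the first contains 0, whereas the source of the second
  -- is a point other than 0.
  ⊑-trans : Transitive _⊑_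
  ⊑-trans (inside c≡ uv) (inside c≡′ vw) = inside (trans c≡ c≡′) (inside-trans uv vw)
  ⊑-trans {u} {v} (inside c≡ uv) (across c≢ sv≡0 kv<r r≤)
    with refl ← inside-same-s c≡ uv
           (trans (ℕ.n≤0⇒n≡0 (subst (s u ≤_) sv≡0 (inside-s uv))) (sym sv≡0)) =
    across c≢ sv≡0 kv<r r≤
  ⊑-trans (across c≢ su≡0 ku<r r≤tv) (inside c≡ vw) =
    across (λ eq → c≢ (trans eq (sym c≡))) su≡0 ku<r (ℕ.≤-trans r≤tv (inside-t vw))
  ⊑-trans (across _ _ _ r≤tv) (across _ sv≡0 kv<r _) =
    contradiction r≤tv (singleton-t< sv≡0 kv<r)

  ⊑-refl : ∀ {u} → u ⊑ u
  ⊑-refl = inside refl (direct ℕ.≤-refl ℕ.≤-refl)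

  ⊑-antisym : Antisymmetric _≡_ _⊑_
  ⊑-antisym (inside c≡ uv) (inside _ vu) =
    inside-same-s c≡ uv (ℕ.≤-antisym (inside-s uv) (inside-s vu))
  ⊑-antisym (inside c≡ _) (across c≢ _ _ _) = contradiction (sym c≡) c≢
  ⊑-antisym (across c≢ _ _ _) (inside c≡ _) = contradiction (sym c≡) c≢
  ⊑-antisym (across _ su≡0 ku<r _) (across _ _ _ r≤tu) =
    contradiction r≤tu (singleton-t< su≡0 ku<r)

  inside? : Decidable Inside
  inside? u v = map′ (λ { (inj₁ (k≤ , t≤)) → direct k≤ t≤ ; (inj₂ t≤) → around t≤ })
                     (λ { (direct k≤ t≤) → inj₁ (k≤ , t≤) ; (around t≤) → inj₂ t≤ })
                     ((k v ℕ.≤? k u ×-dec t u ℕ.≤? t v) ⊎-dec (t u + N ℕ.≤? t v))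

  _⊑?_ : Decidable _⊑_
  u ⊑? v with copy u Fin.≟ copy v
  ... | yes c≡ = map′ (inside c≡) (λ { (inside _ uv) → uv ; (across c≢ _ _ _) → contradiction c≡ c≢ })
                      (inside? u v)
  ... | no  c≢ = map′ (λ (su≡0 , ku<r , r≤) → across c≢ su≡0 ku<r r≤)
                      (λ { (inside c≡ _) → contradiction c≡ c≢
                         ; (across _ su≡0 ku<r r≤) → su≡0 , ku<r , r≤ })
                      (s u ℕ.≟ 0 ×-dec k u ℕ.<? r ×-dec r ℕ.≤? t v)

  arcPoset : FinPoset
  arcPoset = record
    { size = size
    ; _⊑_  = _⊑_
    ; isDecPartialOrder = record
      { isPartialOrder = record
        { isPreorder = record
          { isEquivalence = isEquivalence
          ; reflexive     = λ { refl → ⊑-refl }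
          ; trans         = ⊑-trans
          }
        ; antisym = ⊑-antisym
        }
      ; _≟_  = Fin._≟_
      ; _≤?_ = _⊑?_
      }
    }

  -- Arcs that contain 0 move up by one level to make room for the one-point arcs of the other copy
  -- below them. As s < r, the values are 0 to r, whence the height r + 1.
  rank : Fin size → ℕ
  rank u with r ℕ.≤? t u
  ... | yes _ = suc (s u)
  ... | no  _ = s u

  rank≤r : ∀ u → rank u ≤ r
  rank≤r u with r ℕ.≤? t u
  ... | yes _ = s<r u
  ... | no  _ = ℕ.<⇒≤ (s<r u)

  rank-strict : ∀ {u v} → u ⊑ v → rank u ≡ rank v → u ≡ v
  rank-strict {u} {v} u⊑v eq with r ℕ.≤? t u | r ℕ.≤? t v | u⊑v
  ... | yes _ | yes _ | inside c≡ uv = inside-same-s c≡ uv (ℕ.suc-injective eq)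
  ... | no  _ | no  _ | inside c≡ uv = inside-same-s c≡ uv eq
  ... | no  _ | yes _ | inside _ uv = contradiction (inside-s uv) (ℕ.<⇒≱ (subst (s v <_) (sym eq) ℕ.≤-refl))
  ... | yes p | no ¬p | inside _ uv = contradiction (ℕ.≤-trans p (inside-t uv)) ¬p
  ... | _     | no ¬p | across _ _ _ q = contradiction q ¬p
  ... | no  _ | yes _ | across _ su≡0 _ _ = contradiction (trans (sym eq) su≡0) λ ()
  ... | yes p | yes _ | across _ su≡0 ku<r _ =
    contradiction p (singleton-t< su≡0 ku<r)

  -- Cover relations of the poset of arcs

  open Element

  -- In terms of arcs, the first three constructors add a point at the lower end (keep) or at the
  -- upper end (drop, or wrap if the new point is 0).
  data Step (u v : Fin size) : Set where
    keep : copy u ≡ copy v → k u ≡ k v → s v ≡ suc (s u) → Step u v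
    drop : copy u ≡ copy v → k u ≡ suc (k v) → s v ≡ suc (s u) → Step u v
    wrap : copy u ≡ copy v → k u ≡ 0 → k v ≡ r → s v ≡ suc (s u) → Step u v
    jump : copy u ≢ copy v → s u ≡ 0 → k u < r → s v ≡ 0 → k v ≡ r → Step u v

  step : ∀ {u v} → Cover arcPoset u v → Step u v
  step {u} {v} (u⊑v , u≢v , gap) = from u⊑v
    where
    -- Nothing lies strictly between `u` and `v`, so any `w` between them other than `u` is `v`.
    -- Each case below exhibits such a `w` and reads off the coordinates of `v`.
    tight : ∀ {c i j} (w : Element c i j) → this w ≢ u → u ⊑ this w → this w ⊑ v →
            copy v ≡ c × k v ≡ i × s v ≡ j
    tight (element w refl refl refl) w≢u u⊑w w⊑v with w Fin.≟ v
    ... | yes refl = refl , refl , refl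
    ... | no  w≢v  = contradiction (w , w≢u , w≢v , u⊑w , w⊑v) gap

    from : u ⊑ v → Step u v
    -- The candidate is {0} in the copy of `v`, through which every relation between the copies
    -- factors.
    from (across c≢ su≡0 ku<r r≤) with at (copy v) (ℕ.≤-refl {r}) (ℕ.≤-<-trans z≤n (s<r u))
    ... | w@(element _ wc wk ws)
      with _ , kv , sv ← tight w (λ { refl → c≢ wc })
             (across (λ eq → c≢ (trans eq wc)) su≡0 ku<r (ℕ.≤-reflexive (sym (cong₂ _+_ ws wk))))
             (inside wc (direct (subst (k v ≤_) (sym wk) (k≤r v))
               (subst (_≤ t v) (sym (cong₂ _+_ ws wk)) r≤))) =
      jump c≢ su≡0 ku<r sv kv
    from (inside c≡ ins) = climb ins
      where
      s< : s u < s v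
      s< = ℕ.≤∧≢⇒< (inside-s ins) (u≢v ∘ inside-same-s c≡ ins)

      above : ∀ {i} → i ≤ r → Element (copy v) i (suc (s u))
      above i≤r = at (copy v) i≤r (ℕ.≤-<-trans s< (s<r v))

      move : ∀ {i} (w : Element (copy v) i (suc (s u))) →
             (∀ {w} → k w ≡ i → s w ≡ suc (s u) → Inside u w × Inside w v) →
             k v ≡ i × s v ≡ suc (s u)
      move w@(element _ wc wk ws) between with uw , wv ← between wk ws =
        proj₂ (tight w (λ { refl → ℕ.1+n≢n (sym ws) }) (inside (trans c≡ (sym wc)) uw) (inside wc wv))

      t-lower : ∀ {w i} → k w ≡ i → k u ≡ suc i → s w ≡ suc (s u) → t w ≡ t u
      t-lower {w} wk uk ws = trans (cong₂ _+_ ws wk) (trans (sym (ℕ.+-suc (s u) _)) (cong (s u +_) (sym uk)))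

      -- A new point at the upper end lowers `k` by one and leaves the lower end, hence `t`, where
      -- it was.
      lower : ∀ {i} → k u ≡ suc i → (∀ {w} → k w ≡ i → t w ≡ t u → Inside w v) → Step u v
      lower {i} uk wv = drop c≡ (trans uk (cong suc (sym (proj₁ kv×sv)))) (proj₂ kv×sv)
        where
        i<k : i < k u
        i<k = ℕ.≤-reflexive (sym uk)
        kv×sv : k v ≡ i × s v ≡ suc (s u)
        kv×sv = move (above (ℕ.≤-trans (ℕ.<⇒≤ i<k) (k≤r u))) λ wk ws →
          direct (ℕ.≤-trans (ℕ.≤-reflexive wk) (ℕ.<⇒≤ i<k)) (ℕ.≤-reflexive (sym (t-lower wk uk ws))) ,
          wv wk (t-lower wk uk ws)

      straight : k v ≡ k u → Step u v
      straight kv≡ku = keep c≡ (sym kv≡ku) (proj₂ kv×sv)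
        where
        kv×sv : k v ≡ k u × s v ≡ suc (s u)
        kv×sv = move (above (k≤r u)) λ wk ws →
          direct (ℕ.≤-reflexive wk)
            (ℕ.+-mono-≤ (ℕ.≤-trans (ℕ.n≤1+n _) (ℕ.≤-reflexive (sym ws))) (ℕ.≤-reflexive (sym wk))) ,
          direct (ℕ.≤-reflexive (trans kv≡ku (sym wk)))
            (ℕ.+-mono-≤ (ℕ.≤-trans (ℕ.≤-reflexive ws) s<) (ℕ.≤-reflexive (trans wk (sym kv≡ku))))

      -- The upper end of `u` is the point r, so the next point is 0, which has k = r. The new `t`
      -- is exactly t u + N, so `around` holds with equality.
      round : k u ≡ 0 → t u + N ≤ t v → Step u v
      round uk t≤ = wrap c≡ uk (proj₁ kv×sv) (proj₂ kv×sv)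
        where
        t≡ : ∀ {w} → k w ≡ r → s w ≡ suc (s u) → t w ≡ t u + N
        t≡ {w} wk ws = trans (cong₂ _+_ ws wk) (trans (lemma (s u) r) (cong (λ x → s u + x + N) (sym uk)))
          where
          lemma : ∀ s r → suc s + r ≡ s + 0 + suc r
          lemma = solve-∀
        kv×sv : k v ≡ r × s v ≡ suc (s u)
        kv×sv = move (above ℕ.≤-refl) λ wk ws →
          around (ℕ.≤-reflexive (sym (t≡ wk ws))) ,
          direct (ℕ.≤-trans (k≤r v) (ℕ.≤-reflexive (sym wk))) (ℕ.≤-trans (ℕ.≤-reflexive (t≡ wk ws)) t≤)

      -- `u` grows by one point within `v`: at the lower end if the lifted upper ends agree, and at
      -- the upper end otherwise. The latter passes the point 0 exactly if k u = 0.
      climb : Inside u v → Step u v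
      climb (direct k≤ t≤) with k u in uk
      ... | zero = straight (trans (ℕ.n≤0⇒n≡0 k≤) (sym uk))
      ... | suc i with k v ℕ.≟ suc i
      ...   | yes kv≡ = straight (trans kv≡ (sym uk))
      ...   | no  kv≢ = lower uk λ wk wt →
        direct (ℕ.≤-trans (ℕ.≤-pred (ℕ.≤∧≢⇒< k≤ kv≢)) (ℕ.≤-reflexive (sym wk)))
               (ℕ.≤-trans (ℕ.≤-reflexive (trans wt (cong (s u +_) uk))) t≤)
      climb (around t≤) with k u in uk
      ... | zero  = round uk (subst (λ x → s u + x + N ≤ t v) (sym uk) t≤)
      ... | suc i = lower uk λ wk wt →
        around (ℕ.≤-trans (ℕ.≤-reflexive (cong (_+ N) (trans wt (cong (s u +_) uk)))) t≤)

  step⇒< : ∀ {u v} → Step u v → u Fin.< v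
  step⇒< {u} (keep _ _ s≡)      = s<⇒< (subst (s u <_) (sym s≡) ℕ.≤-refl)
  step⇒< {u} (drop _ _ s≡)      = s<⇒< (subst (s u <_) (sym s≡) ℕ.≤-refl)
  step⇒< {u} (wrap _ _ _ s≡)    = s<⇒< (subst (s u <_) (sym s≡) ℕ.≤-refl)
  step⇒< {u} (jump _ su ku sv kv) = k<⇒< (trans su (sym sv)) (subst (k u <_) (sym kv) ku)

  -- Height and standard example of the poset of arcs

  module Nonempty {m} (r≡ : r ≡ suc m) where
    private
      0<r : 0 < r
      0<r = subst (0 <_) (sym r≡) (s≤s z≤n)
      m<r : m < r
      m<r = ℕ.≤-reflexive (sym r≡)

    -- The point r of the second copy, followed by the arcs of the first copy with upper end 0, from
    -- {0} up to r points.
    chain : Fin (suc r) → Fin size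
    chain zero    = this (at (suc zero) {0} {0} z≤n 0<r)
    chain (suc i) = this (at zero ℕ.≤-refl (toℕ<n i))

    private
      link : ∀ {c i i′ j j′} (u : Element c i j) (v : Element c i′ j′) →
             i′ ≤ i → j + i ≤ j′ + i′ → this u ⊑ this v
      link (element _ uc refl refl) (element _ vc refl refl) k≤ t≤ =
        inside (trans uc (sym vc)) (direct k≤ t≤)

      cross : ∀ {c d i i′ j′} (u : Element c i 0) (v : Element d i′ j′) →
              c ≢ d → i < r → r ≤ j′ + i′ → this u ⊑ this v
      cross (element _ refl refl s≡) (element _ refl refl refl) c≢d k< t≤ = across c≢d s≡ k< t≤

    chain-mono : ∀ {i j} → i Fin.≤ j → chain i ⊑ chain j
    chain-mono {zero}  {zero}  _ = ⊑-refl
    chain-mono {zero}  {suc j} _ = cross (at (suc zero) z≤n 0<r) (at zero ℕ.≤-refl (toℕ<n j))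
      (λ ()) 0<r (ℕ.m≤n+m r (toℕ j))
    chain-mono {suc i} {suc j} (s≤s i≤j) = link (at zero ℕ.≤-refl (toℕ<n i)) (at zero ℕ.≤-refl (toℕ<n j))
      ℕ.≤-refl (ℕ.+-monoˡ-≤ r i≤j)

    chain-injective : ∀ {i j} → chain i ≡ chain j → i ≡ j
    chain-injective {zero}  {zero}  _  = refl
    chain-injective {zero}  {suc j} eq = contradiction
      (trans (sym (copy≡ (at (suc zero) {0} {0} z≤n 0<r)))
        (trans (cong copy eq) (copy≡ (at zero ℕ.≤-refl (toℕ<n j))))) λ ()
    chain-injective {suc i} {zero}  eq = contradiction
      (trans (sym (copy≡ (at zero ℕ.≤-refl (toℕ<n i))))
        (trans (cong copy eq) (copy≡ (at (suc zero) {0} {0} z≤n 0<r)))) λ ()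
    chain-injective {suc i} {suc j} eq = cong suc (toℕ-injective
      (trans (sym (s≡ (at zero ℕ.≤-refl (toℕ<n i))))
        (trans (cong s eq) (s≡ (at zero ℕ.≤-refl (toℕ<n j))))))

    height : HasHeight arcPoset (suc r)
    height = hasHeight arcPoset (λ u → fromℕ< (s≤s (rank≤r u)))
      (λ {u} {v} u⊑v eq → rank-strict u⊑v
        (trans (sym (toℕ-fromℕ< (s≤s (rank≤r u)))) (trans (cong toℕ eq) (toℕ-fromℕ< (s≤s (rank≤r v))))))
      chain chain-injective chain-mono

    private
      copyOf : Fin (2 * r) → Fin 2
      copyOf = proj₁ ∘ remQuot {2} r

      pointOf : Fin (2 * r) → Fin r
      pointOf = proj₂ ∘ remQuot {2} r

      atom : ∀ p → Element (copyOf p) (toℕ (pointOf p)) 0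
      atom p = at (copyOf p) (ℕ.<⇒≤ (toℕ<n (pointOf p))) 0<r

      -- An index (c , i) names the point r - i of copy c, which is not 0 since i < r. The r points
      -- downwards from r - (i + 1) leave out just this point.
      coatom : ∀ p → Element (copyOf p) (suc (toℕ (pointOf p))) m
      coatom p = at (copyOf p) (toℕ<n (pointOf p)) m<r

    singleton cosingleton : Fin (2 * r) → Fin size
    singleton   = this ∘ atom
    cosingleton = this ∘ coatom

    private
      a⊑b : ∀ {c d} {i j : Fin r} → (c , i) ≢ (d , j) →
            (u : Element c (toℕ i) 0) (v : Element d (suc (toℕ j)) m) → this u ⊑ this v
      a⊑b {c} {d} {i} {j} ≢ (element u uc uk us) (element v vc vk vs) with c Fin.≟ d
      -- The complement of a point other than 0 contains 0.
      ... | no c≢d = across (λ eq → c≢d (trans (sym uc) (trans eq vc))) us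
        (subst (_< r) (sym uk) (toℕ<n i)) (subst (r ≤_) (sym (cong₂ _+_ vs vk))
          (subst₂ _≤_ (sym r≡) (sym (ℕ.+-suc m (toℕ j))) (s≤s (ℕ.m≤m+n m (toℕ j)))))
      -- The large arc occupies - j to r - j - 1. This range holds r - i itself if j < i, and its
      -- translate - i - 1 if i < j.
      ... | yes refl with ℕ.<-cmp (toℕ i) (toℕ j)
      ...   | tri< i<j _ _ = inside (trans uc (sym vc)) (around
        (subst₂ _≤_ (sym (cong (_+ N) (cong₂ _+_ us uk))) (sym (cong₂ _+_ vs vk))
          (subst (λ x → toℕ i + suc x ≤ m + suc (toℕ j)) (sym r≡) (lin 0 i<j (lemma (toℕ i) (toℕ j) m)))))
        where
        lemma : ∀ i j m → i + suc (suc m) + j + 0 ≡ m + suc j + suc i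
        lemma = solve-∀
      ...   | tri≈ _ i≡j _ = contradiction (cong (c ,_) (toℕ-injective i≡j)) ≢
      ...   | tri> _ _ j<i = inside (trans uc (sym vc)) (direct
        (subst₂ _≤_ (sym vk) (sym uk) j<i)
        (subst₂ _≤_ (sym (cong₂ _+_ us uk)) (sym (cong₂ _+_ vs vk))
          (ℕ.≤-trans (ℕ.≤-pred (subst (toℕ i <_) r≡ (toℕ<n i))) (ℕ.m≤m+n m (suc (toℕ j))))))

    singleton⊑cosingleton : ∀ {p q} → p ≢ q → singleton p ⊑ cosingleton q
    singleton⊑cosingleton {p} {q} p≢q = a⊑b
      (λ eq → p≢q (trans (sym (combine-remQuot {2} r p))
        (trans (cong (uncurry combine) eq) (combine-remQuot {2} r q)))) (atom p) (coatom q)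

    singleton⋢cosingleton : ∀ p → ¬ singleton p ⊑ cosingleton p
    singleton⋢cosingleton p = a⋢b (atom p) (coatom p)
      where
      a⋢b : ∀ {c i} (u : Element c i 0) (v : Element c (suc i) m) → ¬ this u ⊑ this v
      a⋢b (element _ _ refl _) (element _ _ vk _) (inside _ (direct k≤ _)) =
        ℕ.1+n≰n (subst (_≤ _) vk k≤)
      a⋢b {i = i} (element u _ uk us) (element v _ vk vs) (inside _ (around t≤)) = ℕ.1+n≰n {m}
        (lin 0 (subst₂ _≤_ (cong₂ _+_ (cong₂ _+_ us uk) (cong suc r≡)) (cong₂ _+_ vs vk) t≤) (lemma i m))
        where
        lemma : ∀ i m → suc m + (m + suc i) + 0 ≡ m + (i + suc (suc m))
        lemma = solve-∀
      a⋢b (element _ uc _ _) (element _ vc _ _) (across c≢ _ _ _) = c≢ (trans uc (sym vc))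

    dimension : ∃[ d ] (HasDimension arcPoset d × 2 * r ≤ d)
    dimension with d , hd ← Dimension.hasDimension arcPoset =
      d , hd , Dimension.standardExample⇒≤ arcPoset singleton cosingleton
                 singleton⊑cosingleton singleton⋢cosingleton (proj₁ hd)

-- Rational plane geometry

module Plane where
  open import Data.Rational.Base using (_+_; _*_; _-_; -_; _≤_; *≤*; nonNegative)
  open import Data.Rational.Properties
  open import Tactic.RingSolver using (solve-∀; solve)

  private variable
    a b e : ℚ

  ℚ-ring : AlmostCommutativeRing 0ℓ 0ℓ
  ℚ-ring = fromCommutativeRing +-*-commutativeRing (λ x → dec⇒maybe (0ℚ ≟ x))

  infixl 6 _⊕_
  infixl 7 _⊗_

  _⊕_ : 0ℚ ≤ a → 0ℚ ≤ b → 0ℚ ≤ a + b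
  _⊕_ = +-mono-≤

  _⊗_ : 0ℚ ≤ a → 0ℚ ≤ b → 0ℚ ≤ a * b
  _⊗_ {a} {b} p q = subst (_≤ a * b) (*-zeroʳ a) (*-monoˡ-≤-nonNeg a {{nonNegative p}} q)

  slack : a ≤ b → 0ℚ ≤ b - a
  slack {a} {b} p = subst (_≤ b - a) (+-inverseʳ a) (+-monoˡ-≤ (- a) p)

  gap : a ≡ b → 0ℚ ≤ b - a
  gap eq = slack (≤-reflexive eq)

  gap˘ : a ≡ b → 0ℚ ≤ a - b
  gap˘ eq = gap (sym eq)

  -- The form of most inequalities below: the difference of the sides is exhibited as a sum of
  -- products of quantities known to be nonnegative, and the ring solver checks the identity.
  unslack : 0ℚ ≤ e → b - a ≡ e → a ≤ b
  unslack {e} {b} {a} p eq =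
    subst₂ _≤_ (+-identityˡ a) (trans (cong (_+ a) (sym eq)) (cancel a b)) (+-monoˡ-≤ a p)
    where
    cancel : ∀ a b → b - a + a ≡ b
    cancel = solve-∀ ℚ-ring

  -- An equation transfers to every equation with the same difference of sides.
  shift : ∀ {c d} → c ≡ d → a - b ≡ c - d → a ≡ b
  shift {a} {b} {c} refl eq = trans (sym (cancel a b))
      (trans (cong (_+ b) (trans eq (+-inverseʳ c))) (+-identityˡ b))
    where
    cancel : ∀ a b → a - b + b ≡ a
    cancel = solve-∀ ℚ-ring

  -- The refutations are Farkas certificates: a nonnegative combination of the hypotheses that
  -- equals - 1.
  impossible : 0ℚ ≤ e → e ≡ - 1ℚ → ⊥
  impossible p refl with *≤* () ← p

  0≤1 : 0ℚ ≤ 1ℚ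
  0≤1 = nonNegative⁻¹ 1ℚ

  Unit : ℚ → Set
  Unit t = 0ℚ ≤ t × t ≤ 1ℚ

  -- Bends of the edge from (0 , S) to (R , S + 1), where R is the last column. On the cylinder
  -- column 0 returns as column R + 1, so `corner₃` is a second image of the start, from which the
  -- edge finishes like an ordinary diagonal one. The other two bends lead around the grid from one
  -- image to the other.
  corner₁ corner₂ corner₃ : ℚ → ℚ → Point
  corner₁ R S = S + S - (R + R) , R + R - S
  corner₂ R S = R + 1ℚ + (R + R) - (S + S) , R + R - S
  corner₃ R S = R + 1ℚ , S

  module Detour (R S : ℚ) where
    -- On the first three segments of the detour, min (x + y) (R + 1 - x + y) (2R - y) is
    -- constantly S; hence detours for distinct S are disjoint there.
    record Legs (x y : ℚ) : Set where
      constructor legs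
      field
        S≤left  : S ≤ x + y
        S≤top   : S ≤ R + R - y
        S≤right : S ≤ R + 1ℚ - x + y

    data Side (x y : ℚ) : Set where
      left  : x ≤ 0ℚ → x + y ≡ S → Side x y
      top   : R ≤ y → R + R - y ≡ S → Side x y
      right : R + 1ℚ ≤ x → R + 1ℚ - x + y ≡ S → Side x y

    record Tail (x y : ℚ) : Set where
      constructor tail
      field
        diagonal : x + y ≡ R + 1ℚ + S
        S≤y : S ≤ y
        y≤  : y ≤ S + 1ℚ

    Wrapped : ℚ → ℚ → Set
    Wrapped x y = (Legs x y × Side x y) ⊎ Tail x y

  -- Columns 0 to R, and rows up to R - 1. It contains the edges inside the grid, and the detours
  -- meet it only in their ends (`wrapped-box`).
  Box : ℚ → ℚ → ℚ → Set
  Box R x y = 0ℚ ≤ x × x ≤ R × y + 1ℚ ≤ R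

  module DetourProperties (R S : ℚ) (0≤S : 0ℚ ≤ S) (S+2≤R : S + 1ℚ + 1ℚ ≤ R) where
    open Detour R S

    private
      S≤R : S ≤ R
      S≤R = unslack (slack S+2≤R ⊕ 0≤1 ⊕ 0≤1) (solve (R ∷ S ∷ []) ℚ-ring)

      w : 0ℚ ≤ R - S
      w = slack S≤R

    onLeft : ∀ {x y} → OnSegment (0ℚ , S) (S + S - (R + R) , R + R - S) (x , y) →
             Legs x y × x ≤ 0ℚ × x + y ≡ S
    onLeft (t , 0≤t , t≤1 , refl) =
      legs (unslack ≤-refl (solve (R ∷ S ∷ t ∷ []) ℚ-ring))
           (unslack (slack t≤1 ⊗ (w ⊕ w)) (solve (R ∷ S ∷ t ∷ []) ℚ-ring))
           (unslack (0≤t ⊗ (w ⊕ w ⊕ w ⊕ w) ⊕ w ⊕ 0≤S ⊕ 0≤1) (solve (R ∷ S ∷ t ∷ []) ℚ-ring)) ,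
      unslack (0≤t ⊗ (w ⊕ w)) (solve (R ∷ S ∷ t ∷ []) ℚ-ring) ,
      solve (R ∷ S ∷ t ∷ []) ℚ-ring

    onTop : ∀ {x y} →
            OnSegment (S + S - (R + R) , R + R - S)
                      (R + 1ℚ + (R + R) - (S + S) , R + R - S) (x , y) →
            Legs x y × R ≤ y × R + R - y ≡ S
    onTop (t , 0≤t , t≤1 , refl) =
      -- The top side has length 5R + 1 - 4S, written as 5(R - S) + S + 1 to show its sign.
      legs (unslack (0≤t ⊗ (w ⊕ w ⊕ w ⊕ w ⊕ w ⊕ 0≤S ⊕ 0≤1)) (solve (R ∷ S ∷ t ∷ []) ℚ-ring))
           (unslack ≤-refl (solve (R ∷ S ∷ t ∷ []) ℚ-ring))
           (unslack (slack t≤1 ⊗ (w ⊕ w ⊕ w ⊕ w ⊕ w ⊕ 0≤S ⊕ 0≤1)) (solve (R ∷ S ∷ t ∷ []) ℚ-ring)) ,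
      unslack w (solve (R ∷ S ∷ t ∷ []) ℚ-ring) ,
      solve (R ∷ S ∷ t ∷ []) ℚ-ring

    onRight : ∀ {x y} → OnSegment (R + 1ℚ + (R + R) - (S + S) , R + R - S) (R + 1ℚ , S) (x , y) →
              Legs x y × R + 1ℚ ≤ x × R + 1ℚ - x + y ≡ S
    onRight (t , 0≤t , t≤1 , refl) =
      legs (unslack (slack t≤1 ⊗ (w ⊕ w ⊕ w ⊕ w) ⊕ w ⊕ 0≤S ⊕ 0≤1) (solve (R ∷ S ∷ t ∷ []) ℚ-ring))
           (unslack (0≤t ⊗ (w ⊕ w)) (solve (R ∷ S ∷ t ∷ []) ℚ-ring))
           (unslack ≤-refl (solve (R ∷ S ∷ t ∷ []) ℚ-ring)) ,
      unslack (slack t≤1 ⊗ (w ⊕ w)) (solve (R ∷ S ∷ t ∷ []) ℚ-ring) ,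
      solve (R ∷ S ∷ t ∷ []) ℚ-ring

    onTail : ∀ {x y} → OnSegment (R + 1ℚ , S) (R , S + 1ℚ) (x , y) → Tail x y
    onTail (t , 0≤t , t≤1 , refl) = tail (solve (R ∷ S ∷ t ∷ []) ℚ-ring)
      (unslack 0≤t (solve (R ∷ S ∷ t ∷ []) ℚ-ring))
      (unslack (slack t≤1) (solve (R ∷ S ∷ t ∷ []) ℚ-ring))

    private
      0≤R : 0ℚ ≤ R
      0≤R = unslack (w ⊕ 0≤S) (solve (R ∷ S ∷ []) ℚ-ring)

    left-top : ∀ {x y} → x + y ≡ S → R + R - y ≡ S → (x , y) ≡ (S + S - (R + R) , R + R - S)
    left-top {x} {y} p q = cong₂ _,_
      (shift (cong₂ _+_ p q) (solve (R ∷ S ∷ x ∷ y ∷ []) ℚ-ring))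
      (shift (sym q) (solve (R ∷ S ∷ y ∷ []) ℚ-ring))

    left-right : ∀ {x} → x ≤ 0ℚ → R + 1ℚ ≤ x → ⊥
    left-right {x} p q = impossible (slack p ⊕ slack q ⊕ 0≤R) (solve (R ∷ x ∷ []) ℚ-ring)

    tail-x≤ : ∀ {x y} → Tail x y → x ≤ R + 1ℚ
    tail-x≤ {x} {y} (tail d p _) = unslack (slack p ⊕ gap d) (solve (R ∷ S ∷ x ∷ y ∷ []) ℚ-ring)

    R≤tail-x : ∀ {x y} → Tail x y → R ≤ x
    R≤tail-x {x} {y} (tail d _ p) = unslack (slack p ⊕ gap˘ d) (solve (R ∷ S ∷ x ∷ y ∷ []) ℚ-ring)

    left-tail : ∀ {x y} → x ≤ 0ℚ → Tail x y → ⊥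
    left-tail {x} p τ = impossible
      (slack p ⊕ slack (R≤tail-x τ) ⊕ slack S+2≤R ⊕ 0≤S ⊕ 0≤1) (solve (R ∷ S ∷ x ∷ []) ℚ-ring)

    top-right : ∀ {x y} → R + R - y ≡ S → R + 1ℚ - x + y ≡ S →
                (x , y) ≡ (R + 1ℚ + (R + R) - (S + S) , R + R - S)
    top-right {x} {y} p q = cong₂ _,_
      (shift (sym (cong₂ _+_ p q)) (solve (R ∷ S ∷ x ∷ y ∷ []) ℚ-ring))
      (shift (sym p) (solve (R ∷ S ∷ y ∷ []) ℚ-ring))

    top-tail : ∀ {x y} → R ≤ y → Tail x y → ⊥
    top-tail {x} {y} p (tail _ _ q) =
      impossible (slack p ⊕ slack q ⊕ slack S+2≤R) (solve (R ∷ S ∷ y ∷ []) ℚ-ring)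

    right-tail : ∀ {x y} → R + 1ℚ ≤ x → Tail x y → (x , y) ≡ (R + 1ℚ , S)
    right-tail {x} {y} p τ@(tail d _ _) = cong₂ _,_ (sym x≡)
      (shift (cong₂ _+_ d x≡) (solve (R ∷ S ∷ x ∷ y ∷ []) ℚ-ring))
      where
      x≡ : R + 1ℚ ≡ x
      x≡ = ≤-antisym p (tail-x≤ τ)

    wrapped-box : ∀ {x y} → Wrapped x y → Box R x y → (x , y) ≡ (0ℚ , S) ⊎ (x , y) ≡ (R , S + 1ℚ)
    wrapped-box {x} {y} (inj₁ (_ , left x≤0 d)) (0≤x , _ , _) = inj₁ (cong₂ _,_ (sym x≡)
      (shift (cong₂ _+_ d x≡) (solve (S ∷ x ∷ y ∷ []) ℚ-ring)))
      where
      x≡ : 0ℚ ≡ x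
      x≡ = ≤-antisym 0≤x x≤0
    wrapped-box {x} {y} (inj₁ (_ , top R≤y _)) (_ , _ , y<R) =
      ⊥-elim (impossible (slack R≤y ⊕ slack y<R) (solve (R ∷ y ∷ []) ℚ-ring))
    wrapped-box {x} {y} (inj₁ (_ , right R<x _)) (_ , x≤R , _) =
      ⊥-elim (impossible (slack R<x ⊕ slack x≤R) (solve (R ∷ x ∷ []) ℚ-ring))
    wrapped-box {x} {y} (inj₂ τ@(tail d _ _)) (_ , x≤R , _) = inj₂ (cong₂ _,_ (sym x≡)
      (shift (cong₂ _+_ d x≡) (solve (R ∷ S ∷ x ∷ y ∷ []) ℚ-ring)))
      where
      x≡ : R ≡ x
      x≡ = ≤-antisym (R≤tail-x τ) x≤R

    wrapped-y : ∀ {x y} → Wrapped x y → 0ℚ ≤ y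
    wrapped-y {x} {y} (inj₁ (_ , left x≤0 d)) =
      unslack (slack x≤0 ⊕ gap˘ d ⊕ 0≤S) (solve (S ∷ x ∷ y ∷ []) ℚ-ring)
    wrapped-y {x} {y} (inj₁ (_ , top R≤y _)) = ≤-trans 0≤R R≤y
    wrapped-y {x} {y} (inj₁ (_ , right R<x d)) =
      unslack (slack R<x ⊕ gap˘ d ⊕ 0≤S) (solve (R ∷ S ∷ x ∷ y ∷ []) ℚ-ring)
    wrapped-y (inj₂ (tail _ S≤y _)) = ≤-trans 0≤S S≤y


    start≢corner₁ : (0ℚ , S) ≢ corner₁ R S
    start≢corner₁ eq = impossible
      (gap˘ (cong proj₂ eq) ⊕ slack S+2≤R ⊕ slack S+2≤R ⊕ 0≤1 ⊕ 0≤1 ⊕ 0≤1) (solve (R ∷ S ∷ []) ℚ-ring)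

    corner₁≢corner₂ : corner₁ R S ≢ corner₂ R S
    corner₁≢corner₂ eq =
      impossible (gap˘ (cong proj₁ eq) ⊕ (w ⊕ w ⊕ w ⊕ w ⊕ 0≤R)) (solve (R ∷ S ∷ []) ℚ-ring)

    corner₂≢corner₃ : corner₂ R S ≢ corner₃ R S
    corner₂≢corner₃ eq = impossible
      (gap (cong proj₂ eq) ⊕ slack S+2≤R ⊕ slack S+2≤R ⊕ 0≤1 ⊕ 0≤1 ⊕ 0≤1) (solve (R ∷ S ∷ []) ℚ-ring)

    corner₃≢finish : corner₃ R S ≢ (R , S + 1ℚ)
    corner₃≢finish eq = impossible (gap (cong proj₁ eq)) (solve (R ∷ []) ℚ-ring)

  module _ {R S S′ : ℚ} where
    open Detour

    -- One of the three linear forms equals S here, while all three are at least S′. Used in both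
    -- directions, this gives S = S′ at a common point of two detours.
    legs-≤ : ∀ {x y} → Side R S x y → Legs R S′ x y → S′ ≤ S
    legs-≤ {x} {y} (left  _ d) l = ≤-trans (Legs.S≤left  l) (≤-reflexive d)
    legs-≤ {x} {y} (top   _ d) l = ≤-trans (Legs.S≤top   l) (≤-reflexive d)
    legs-≤ {x} {y} (right _ d) l = ≤-trans (Legs.S≤right l) (≤-reflexive d)

    tails-≡ : ∀ {x y} → Tail R S x y → Tail R S′ x y → S ≡ S′
    tails-≡ {x} {y} (tail d _ _) (tail d′ _ _) =
      shift (trans (sym d) d′) (solve (R ∷ S ∷ S′ ∷ []) ℚ-ring)

  module _ {R S S′ : ℚ} (0≤S : 0ℚ ≤ S) (S+2≤R : S + 1ℚ + 1ℚ ≤ R) where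
    open Detour
    open DetourProperties R S 0≤S S+2≤R

    -- A tail has no point in common with a left or top side, and reaches the region of the right
    -- sides only in its corner (R + 1 , S), where the other right side has y = S′.
    tail-side : ∀ {x y} → Tail R S x y → Side R S′ x y → S ≡ S′
    tail-side τ (left x≤0 _) = ⊥-elim (left-tail x≤0 τ)
    tail-side τ (top R≤y _)  = ⊥-elim (top-tail R≤y τ)
    tail-side {x} {y} τ@(tail d _ _) (right R<x d′) =
      shift (cong₂ _+_ (cong₂ _+_ d′ x≡) (sym y≡)) (solve (R ∷ S ∷ S′ ∷ x ∷ y ∷ []) ℚ-ring)
      where
      x≡ : x ≡ R + 1ℚ
      x≡ = cong proj₁ (right-tail R<x τ)
      y≡ : y ≡ S
      y≡ = cong proj₂ (right-tail R<x τ)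

  -- By this recursion, `ι-mono` applied to m < n yields the unit gap ι m + 1 ≤ ι n directly.
  ι : ℕ → ℚ
  ι zero    = 0ℚ
  ι (suc n) = ι n + 1ℚ

  0≤ι : ∀ n → 0ℚ ≤ ι n
  0≤ι zero    = ≤-refl
  0≤ι (suc n) = 0≤ι n ⊕ 0≤1

  ι-mono : ∀ {m n} → m ℕ.≤ n → ι m ≤ ι n
  ι-mono {n = n} z≤n = 0≤ι n
  ι-mono (s≤s m≤n) = +-monoˡ-≤ 1ℚ (ι-mono m≤n)

  ι-+ : ∀ m n → ι (m ℕ.+ n) ≡ ι n + ι m
  ι-+ zero    n = sym (+-identityʳ (ι n))
  ι-+ (suc m) n = trans (cong (_+ 1ℚ) (ι-+ m n)) (+-assoc (ι n) (ι m) 1ℚ)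

  ι-reflects-≤ : ∀ {m n} → ι m ≤ ι n → m ℕ.≤ n
  ι-reflects-≤ {m} {n} p with m ℕ.≤? n
  ... | yes m≤n = m≤n
  ... | no  m≰n = ⊥-elim (absurd (ι m) (ι n) p (ι-mono (ℕ.≰⇒> m≰n)))
    where
    absurd : ∀ a b → a ≤ b → b + 1ℚ ≤ a → ⊥
    absurd a b p q = impossible (slack p ⊕ slack q) (solve (a ∷ b ∷ []) ℚ-ring)

  ι-injective : ∀ {m n} → ι m ≡ ι n → m ≡ n
  ι-injective eq = ℕ.≤-antisym (ι-reflects-≤ (≤-reflexive eq)) (ι-reflects-≤ (≤-reflexive (sym eq)))

  integral : ∀ m n {t} → Unit t → ι m ≡ ι n + t → t ≡ 0ℚ ⊎ t ≡ 1ℚ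
  integral m n {t} (0≤t , t≤1) eq with ℕ.<-cmp m n
  ... | tri< m<n _ _  = ⊥-elim (below (ι m) (ι n) t eq (ι-mono m<n) 0≤t)
    where
    below : ∀ a b t → a ≡ b + t → a + 1ℚ ≤ b → 0ℚ ≤ t → ⊥
    below a b t eq p 0≤t = impossible (gap˘ eq ⊕ slack p ⊕ 0≤t) (solve (a ∷ b ∷ t ∷ []) ℚ-ring)
  ... | tri≈ _ refl _ = inj₁ (equal (ι m) t eq)
    where
    equal : ∀ a t → a ≡ a + t → t ≡ 0ℚ
    equal a t eq = shift (sym eq) (solve (a ∷ t ∷ []) ℚ-ring)
  ... | tri> _ _ n<m  = inj₂ (≤-antisym t≤1 (above (ι m) (ι n) t eq (ι-mono n<m)))
    where
    above : ∀ a b t → a ≡ b + t → b + 1ℚ ≤ a → 1ℚ ≤ t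
    above a b t eq p = unslack (slack p ⊕ gap eq) (solve (a ∷ b ∷ t ∷ []) ℚ-ring)

  module Flip (R : ℚ) where
    -- The second copy is drawn as the image of the first under a half-turn, so that the bottom
    -- rows face each other and the vertices {0} lie one above the other.
    flip : Fin 2 → Point → Point
    flip zero       p       = p
    flip (suc zero) (x , y) = R + R - x , - 1ℚ - y

    flip-involutive : ∀ c p → flip c (flip c p) ≡ p
    flip-involutive zero       p       = refl
    flip-involutive (suc zero) (x , y) = cong₂ _,_ (cancel (R + R) x) (cancel (- 1ℚ) y)
      where
      cancel : ∀ a x → a - (a - x) ≡ x
      cancel = solve-∀ ℚ-ring

    flip-injective : ∀ c {p q} → flip c p ≡ flip c q → p ≡ q
    flip-injective c {p} {q} eq =
      trans (sym (flip-involutive c p)) (trans (cong (flip c) eq) (flip-involutive c q))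

    flip-other : ∀ {c d} → c ≢ d → ∀ x y → flip c (flip d (x , y)) ≡ (R + R - x , - 1ℚ - y)
    flip-other {zero}     {zero}     c≢d = contradiction refl c≢d
    flip-other {zero}     {suc zero} c≢d x y = refl
    flip-other {suc zero} {zero}     c≢d x y = refl
    flip-other {suc zero} {suc zero} c≢d = contradiction refl c≢d

    flip-segment : ∀ c p q {z} → OnSegment (flip c p) (flip c q) z → OnSegment p q (flip c z)
    flip-segment zero       p         q         on = on
    flip-segment (suc zero) (a , b) (a′ , b′) (t , 0≤t , t≤1 , refl) = t , 0≤t , t≤1 ,
      cong₂ _,_ (affine (R + R) a a′ t) (affine (- 1ℚ) b b′ t)
      where
      affine : ∀ e a a′ t → e - ((1ℚ - t) * (e - a) + t * (e - a′)) ≡ (1ℚ - t) * a + t * a′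
      affine = solve-∀ ℚ-ring

-- The drawing

≢-≢⇒≡ : ∀ {a b c : Fin 2} → a ≢ b → b ≢ c → a ≡ c
≢-≢⇒≡ {zero}     {zero}     a≢b _ = contradiction refl a≢b
≢-≢⇒≡ {suc zero} {suc zero} a≢b _ = contradiction refl a≢b
≢-≢⇒≡ {zero}     {suc zero} {zero}     _ _ = refl
≢-≢⇒≡ {suc zero} {zero}     {suc zero} _ _ = refl
≢-≢⇒≡ {zero}     {suc zero} {suc zero} _ b≢c = contradiction refl b≢c
≢-≢⇒≡ {suc zero} {zero}     {zero}     _ b≢c = contradiction refl b≢c

module Drawing (r : ℕ) where
  open import Data.Rational.Base using (_+_; _*_; _-_; -_; _≤_)
  open import Data.Rational.Properties
  open import Tactic.RingSolver using (solve-∀; solve)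
  open Plane
  open Arcs r

  R : ℚ
  R = ι r
  open Flip R

  grid pos : Fin size → Point
  grid u = ι (k u) , ι (s u)
  pos u = flip (copy u) (grid u)

  grid-injective : ∀ {u v} → copy u ≡ copy v → grid u ≡ grid v → u ≡ v
  grid-injective c≡ eq = ext c≡ (ι-injective (cong proj₁ eq)) (ι-injective (cong proj₂ eq))

  view-same : ∀ {u v} → copy u ≡ copy v → flip (copy u) (pos v) ≡ grid v
  view-same {v = v} c≡ rewrite c≡ = flip-involutive (copy v) (grid v)

  view-other : ∀ {u v} → copy u ≢ copy v →
               flip (copy u) (pos v) ≡ (R + R - ι (k v) , - 1ℚ - ι (s v))
  view-other c≢ = flip-other c≢ _ _

  below : ∀ {y} → 0ℚ ≤ y → 0ℚ ≤ - 1ℚ - y → ⊥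
  below {y} p q = impossible (p ⊕ q) (solve (y ∷ []) ℚ-ring)

  pos-injective : ∀ {u v} → pos u ≡ pos v → u ≡ v
  pos-injective {u} {v} eq with copy u Fin.≟ copy v
  ... | yes c≡ = grid-injective c≡
    (trans (sym (view-same {u} refl)) (trans (cong (flip (copy u)) eq) (view-same c≡)))
  ... | no  c≢ = ⊥-elim (below (0≤ι (s v)) (subst (0ℚ ≤_) (cong proj₂ grid≡) (0≤ι (s u))))
    where
    grid≡ : grid u ≡ (R + R - ι (k v) , - 1ℚ - ι (s v))
    grid≡ = trans (sym (view-same {u} refl)) (trans (cong (flip (copy u)) eq) (view-other c≢))

  -- `arc` is defined on all pairs, so it tests coordinates. Among covers these single out `wrap`:
  -- `keep` and `drop` have k v ≤ k u, against 0 < r, and `jump` changes the copy.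
  Wraps : Fin size → Fin size → Set
  Wraps u v = copy u ≡ copy v × k u ≡ 0 × k v ≡ r

  wraps? : ∀ u v → Dec (Wraps u v)
  wraps? u v = copy u Fin.≟ copy v ×-dec k u ℕ.≟ 0 ×-dec k v ℕ.≟ r

  -- The edges from column 0 to column r close the cylinder: they pass over the top of the grid
  -- and come down on its other side, as nested trapezoids.
  detour : ∀ u v → Polyline (pos u) (pos v)
  detour u v = pos u ▸ at′ corner₁ ▸ at′ corner₂ ▸ segment (at′ corner₃) (pos v)
    where
    at′ : (ℚ → ℚ → Point) → Point
    at′ corner = flip (copy u) (corner R (ι (s u)))

  arc′ : ∀ u v → Dec (Wraps u v) → Polyline (pos u) (pos v)
  arc′ u v (yes _) = detour u v
  arc′ u v (no _)  = segment (pos u) (pos v)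

  arc : ∀ u v → Polyline (pos u) (pos v)
  arc u v = arc′ u v (wraps? u v)

  -- z is a point of the edge from u to v in the coordinates of the copy of u.
  data Curve (u v : Fin size) (z : Point) : Set where
    lattice : ∀ δ t → copy u ≡ copy v → k u ≡ δ ℕ.+ k v → δ ℕ.≤ 1 → s v ≡ suc (s u) → Unit t →
              z ≡ (ι (k v) + (1ℚ - t) * ι δ , ι (s u) + t) → Curve u v z
    wrapped : copy u ≡ copy v → k u ≡ 0 → k v ≡ r → s v ≡ suc (s u) →
              Detour.Wrapped R (ι (s u)) (proj₁ z) (proj₂ z) → Curve u v z
    jumped  : ∀ t → copy u ≢ copy v → s u ≡ 0 → k u ℕ.< r → s v ≡ 0 → k v ≡ r → Unit t →
              z ≡ (R - (1ℚ - t) * (R - ι (k u)) , - t) → Curve u v z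

  0<r : ∀ {u} → s u ℕ.< r → 0 ℕ.< r
  0<r = ℕ.≤-<-trans z≤n

  S+2≤R : ∀ {u v} → s v ≡ suc (s u) → ι (s u) + 1ℚ + 1ℚ ≤ R
  S+2≤R {u} {v} s≡ = ι-mono (subst (ℕ._< r) s≡ (s<r v))

  module Turn {u v : Fin size} (c≡ : copy u ≡ copy v) (ku : k u ≡ 0) (kv : k v ≡ r)
              (s≡ : s v ≡ suc (s u)) where
    S : ℚ
    S = ι (s u)
    open Detour R S public
    open DetourProperties R S (0≤ι (s u)) (S+2≤R {u} {v} s≡) public

    grid-u : grid u ≡ (0ℚ , S)
    grid-u = cong (λ i → ι i , S) ku

    grid-v : grid v ≡ (R , S + 1ℚ)
    grid-v = cong₂ (λ i j → ι i , ι j) kv s≡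

    pos-u : pos u ≡ flip (copy u) (0ℚ , S)
    pos-u = cong (flip (copy u)) grid-u

    pos-v : pos v ≡ flip (copy u) (R , S + 1ℚ)
    pos-v = trans (cong (λ c → flip c (grid v)) (sym c≡)) (cong (flip (copy u)) grid-v)

    segment-left : ∀ {z} → OnSegment (pos u) (flip (copy u) (corner₁ R S)) z →
                   OnSegment (0ℚ , S) (corner₁ R S) (flip (copy u) z)
    segment-left on = flip-segment (copy u) (0ℚ , S) (corner₁ R S)
      (subst (λ p → OnSegment p (flip (copy u) (corner₁ R S)) _) pos-u on)

    segment-tail : ∀ {z} → OnSegment (flip (copy u) (corner₃ R S)) (pos v) z →
                   OnSegment (corner₃ R S) (R , S + 1ℚ) (flip (copy u) z)
    segment-tail on = flip-segment (copy u) (corner₃ R S) (R , S + 1ℚ)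
      (subst (λ p → OnSegment (flip (copy u) (corner₃ R S)) p _) pos-v on)

    segment-top : ∀ {z} → OnSegment (flip (copy u) (corner₁ R S)) (flip (copy u) (corner₂ R S)) z → 
                  OnSegment (corner₁ R S) (corner₂ R S) (flip (copy u) z)
    segment-top = flip-segment (copy u) (corner₁ R S) (corner₂ R S)

    segment-right : ∀ {z} → OnSegment (flip (copy u) (corner₂ R S)) (flip (copy u) (corner₃ R S)) z → 
                    OnSegment (corner₂ R S) (corner₃ R S) (flip (copy u) z)
    segment-right = flip-segment (copy u) (corner₂ R S) (corner₃ R S)

    unflip : ∀ {p z} → flip (copy u) z ≡ p → z ≡ flip (copy u) p
    unflip {z = z} eq = trans (sym (flip-involutive (copy u) z)) (cong (flip (copy u)) eq)

    detour-wrapped : ∀ {z} → OnPolyline (detour u v) z →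
                     Wrapped (proj₁ (flip (copy u) z)) (proj₂ (flip (copy u) z))
    detour-wrapped (inj₁ on) with l , x≤ , d ← onLeft (segment-left on) = inj₁ (l , left x≤ d)
    detour-wrapped (inj₂ (inj₁ on)) with l , ≤y , d ← onTop (segment-top on) = inj₁ (l , top ≤y d)
    detour-wrapped (inj₂ (inj₂ (inj₁ on))) with l , ≤x , d ← onRight (segment-right on) =
      inj₁ (l , right ≤x d)
    detour-wrapped (inj₂ (inj₂ (inj₂ on))) = inj₂ (onTail (segment-tail on))

    -- The left side lies in x ≤ 0, the top in y ≥ R, the right side in x ≥ R + 1, and the tail in R
    -- ≤ x ≤ R + 1 with y ≤ S + 1 < R. Where two consecutive pieces meet, their equations determine
    -- the corner.
    detour-simple : Simple (detour u v)
    detour-simple =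
      (λ eq → start≢corner₁ (flip-injective (copy u) (trans (sym pos-u) eq))) ,
      (λ z on → let _ , x≤ , d = onLeft (segment-left on) in λ where
        (inj₁ on′) → let _ , _ , d′ = onTop (segment-top on′) in unflip (left-top d d′)
        (inj₂ (inj₁ on′)) → let _ , ≤x , _ = onRight (segment-right on′) in ⊥-elim (left-right x≤ ≤x)
        (inj₂ (inj₂ on′)) → ⊥-elim (left-tail x≤ (onTail (segment-tail on′)))) ,
      (corner₁≢corner₂ ∘ flip-injective (copy u)) ,
      (λ z on → let _ , ≤y , d = onTop (segment-top on) in λ where
        (inj₁ on′) → let _ , _ , d′ = onRight (segment-right on′) in unflip (top-right d d′)
        (inj₂ on′) → ⊥-elim (top-tail ≤y (onTail (segment-tail on′)))) ,
      (corner₂≢corner₃ ∘ flip-injective (copy u)) ,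
      (λ z on on′ → let _ , ≤x , _ = onRight (segment-right on) in
        unflip (right-tail ≤x (onTail (segment-tail on′)))) ,
      (λ eq → corner₃≢finish (flip-injective (copy u) (trans eq pos-v)))

  straight : ∀ {u v z} → OnSegment (pos u) (pos v) z →
             OnSegment (grid u) (flip (copy u) (pos v)) (flip (copy u) z)
  straight {u} {v} {z} on = flip-segment (copy u) (grid u) (flip (copy u) (pos v))
    (subst (λ p → OnSegment (pos u) p z) (sym (flip-involutive (copy u) (pos v))) on)

  lattice-curve : ∀ {u v z} δ → copy u ≡ copy v → k u ≡ δ ℕ.+ k v → δ ℕ.≤ 1 → s v ≡ suc (s u) →
                  OnSegment (pos u) (pos v) z → Curve u v (flip (copy u) z)
  lattice-curve {u} {v} {z} δ c≡ k≡ δ≤1 s≡ on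
    with t , 0≤t , t≤1 , eq ← subst (λ p → OnSegment (grid u) p (flip (copy u) z))
                                (view-same c≡) (straight {u} {v} on) =
    lattice δ t c≡ k≡ δ≤1 s≡ (0≤t , t≤1) (trans eq (cong₂ _,_
      (trans (cong (λ a → (1ℚ - t) * a + t * ι (k v)) (trans (cong ι k≡) (ι-+ δ (k v))))
        (horizontal (ι (k v)) (ι δ) t))
      (trans (cong (λ j → (1ℚ - t) * ι (s u) + t * ι j) s≡) (vertical (ι (s u)) t))))
    where
    horizontal : ∀ a d t → (1ℚ - t) * (a + d) + t * a ≡ a + (1ℚ - t) * d
    horizontal = solve-∀ ℚ-ring
    vertical : ∀ b t → (1ℚ - t) * b + t * (b + 1ℚ) ≡ b + t
    vertical = solve-∀ ℚ-ring

  jump-curve : ∀ {u v z} → copy u ≢ copy v → s u ≡ 0 → k u ℕ.< r → s v ≡ 0 → k v ≡ r →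
               OnSegment (pos u) (pos v) z → Curve u v (flip (copy u) z)
  jump-curve {u} {v} {z} c≢ su ku sv kv on
    with t , 0≤t , t≤1 , eq ← subst (λ p → OnSegment (grid u) p (flip (copy u) z))
                                (view-other c≢) (straight {u} {v} on) =
    jumped t c≢ su ku sv kv (0≤t , t≤1) (trans eq (cong₂ _,_
      (trans (cong (λ i → (1ℚ - t) * ι (k u) + t * (R + R - ι i)) kv) (horizontal R (ι (k u)) t))
      (trans (cong₂ (λ i j → (1ℚ - t) * ι i + t * (- 1ℚ - ι j)) su sv) (vertical t))))
    where
    horizontal : ∀ R a t → (1ℚ - t) * a + t * (R + R - R) ≡ R - (1ℚ - t) * (R - a)
    horizontal = solve-∀ ℚ-ring
    vertical : ∀ t → (1ℚ - t) * 0ℚ + t * (- 1ℚ - 0ℚ) ≡ - t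
    vertical = solve-∀ ℚ-ring

  ¬wraps-lattice : ∀ {u v} δ → k u ≡ δ ℕ.+ k v → ¬ Wraps u v
  ¬wraps-lattice {u} {v} δ k≡ (_ , ku , kv) = ℕ.1+n≰n (ℕ.≤-trans (0<r {u} (s<r u))
    (ℕ.≤-trans (ℕ.≤-reflexive (sym kv)) 
      (ℕ.≤-trans (ℕ.m≤n+m (k v) δ) (ℕ.≤-reflexive (trans (sym k≡) ku)))))

  curve′ : ∀ {u v z} (w : Dec (Wraps u v)) → Step u v → OnPolyline (arc′ u v w) z →
           Curve u v (flip (copy u) z)
  curve′ {u} {v} (yes w) (keep c≡ k≡ s≡)    on = contradiction w (¬wraps-lattice {u} {v} 0 k≡)
  curve′ {u} {v} (yes w) (drop c≡ k≡ s≡)    on = contradiction w (¬wraps-lattice {u} {v} 1 k≡)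
  curve′ (yes _) (wrap c≡ ku kv s≡) on = wrapped c≡ ku kv s≡ (Turn.detour-wrapped c≡ ku kv s≡ on)
  curve′ (yes (c≡ , _)) (jump c≢ _ _ _ _) on = contradiction c≡ c≢
  curve′ (no _)  (keep c≡ k≡ s≡)    on = lattice-curve 0 c≡ k≡ z≤n s≡ on
  curve′ (no _)  (drop c≡ k≡ s≡)    on = lattice-curve 1 c≡ k≡ (s≤s z≤n) s≡ on
  curve′ (no ¬w) (wrap c≡ ku kv s≡) on = contradiction (c≡ , ku , kv) ¬w
  curve′ (no _)  (jump c≢ su ku sv kv) on = jump-curve c≢ su ku sv kv on

  curve : ∀ {u v z} → Step u v → OnPolyline (arc u v) z → Curve u v (flip (copy u) z)
  curve {u} {v} = curve′ (wraps? u v)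

  simple′ : ∀ {u v} (w : Dec (Wraps u v)) → Step u v → Simple (arc′ u v w)
  simple′ {u} {v} (yes w) (keep c≡ k≡ s≡) = contradiction w (¬wraps-lattice {u} {v} 0 k≡)
  simple′ {u} {v} (yes w) (drop c≡ k≡ s≡) = contradiction w (¬wraps-lattice {u} {v} 1 k≡)
  simple′ (yes _) (wrap c≡ ku kv s≡) = Turn.detour-simple c≡ ku kv s≡
  simple′ (yes (c≡ , _)) (jump c≢ _ _ _ _) = contradiction c≡ c≢
  simple′ (no _) st eq = Fin.<⇒≢ (step⇒< st) (pos-injective eq)

  at-u : ∀ {u z} → flip (copy u) z ≡ grid u → z ≡ pos u
  at-u {u} eq = flip-injective (copy u) (trans eq (sym (view-same {u} refl)))

  at-v : ∀ {u v z} → copy u ≡ copy v → flip (copy u) z ≡ grid v → z ≡ pos v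
  at-v {u} c≡ eq = flip-injective (copy u) (trans eq (sym (view-same c≡)))

  lattice-0 : ∀ {u v z δ t} → k u ≡ δ ℕ.+ k v →
              flip (copy u) z ≡ (ι (k v) + (1ℚ - t) * ι δ , ι (s u) + t) → t ≡ 0ℚ → z ≡ pos u
  lattice-0 {u} {v} {z} {δ} k≡ eq refl = at-u (trans eq (cong₂ _,_
    (trans (simplify (ι (k v)) (ι δ)) (sym (trans (cong ι k≡) (ι-+ δ (k v)))))
    (+-identityʳ (ι (s u)))))
    where
    simplify : ∀ a d → a + (1ℚ - 0ℚ) * d ≡ a + d
    simplify = solve-∀ ℚ-ring

  lattice-1 : ∀ {u v z δ t} → copy u ≡ copy v → s v ≡ suc (s u) →
              flip (copy u) z ≡ (ι (k v) + (1ℚ - t) * ι δ , ι (s u) + t) → t ≡ 1ℚ → z ≡ pos v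
  lattice-1 {u} {v} {z} {δ} c≡ s≡ eq refl = at-v c≡ (trans eq (cong₂ _,_
    (simplify (ι (k v)) (ι δ)) (sym (cong ι s≡))))
    where
    simplify : ∀ a d → a + (1ℚ - 1ℚ) * d ≡ a
    simplify = solve-∀ ℚ-ring

  jumped-0 : ∀ {u z t} → s u ≡ 0 →
             flip (copy u) z ≡ (R - (1ℚ - t) * (R - ι (k u)) , - t) → t ≡ 0ℚ → z ≡ pos u
  jumped-0 {u} su eq refl = at-u (trans eq (cong₂ _,_ (simplify R (ι (k u))) (sym (cong ι su))))
    where
    simplify : ∀ R a → R - (1ℚ - 0ℚ) * (R - a) ≡ a
    simplify = solve-∀ ℚ-ring

  jumped-1 : ∀ {u v z t} → copy u ≢ copy v → s v ≡ 0 → k v ≡ r →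
             flip (copy u) z ≡ (R - (1ℚ - t) * (R - ι (k u)) , - t) → t ≡ 1ℚ → z ≡ pos v
  jumped-1 {u} {v} c≢ sv kv eq refl = flip-injective (copy u) (trans eq (trans
    (cong₂ _,_ (simplify R (ι (k u))) refl)
    (sym (trans (view-other c≢) (cong₂ (λ i j → R + R - ι i , - 1ℚ - ι j) kv sv)))))
    where
    simplify : ∀ R a → R - (1ℚ - 1ℚ) * (R - a) ≡ R + R - R
    simplify = solve-∀ ℚ-ring

  t≡0 : ∀ {t} → 0ℚ ≤ t → 0ℚ ≤ - t → t ≡ 0ℚ
  t≡0 {t} 0≤t t≤0 = ≤-antisym (unslack t≤0 (solve (t ∷ []) ℚ-ring)) 0≤t

  lattice-box : ∀ {u v x y δ t} → k u ≡ δ ℕ.+ k v → s v ≡ suc (s u) → Unit t →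
                (x , y) ≡ (ι (k v) + (1ℚ - t) * ι δ , ι (s u) + t) → Box R x y
  lattice-box {u} {v} {δ = δ} {t = t} k≡ s≡ (0≤t , t≤1) refl =
    (0≤ι (k v) ⊕ slack t≤1 ⊗ 0≤ι δ) ,
    upper (ι (k v)) (ι δ) t R 0≤t t≤1 (ι-mono (k≤r v))
      (subst (_≤ R) (trans (cong ι k≡) (ι-+ δ (k v))) (ι-mono (k≤r u))) ,
    top (ι (s u)) t R t≤1 (S+2≤R {u} {v} s≡)
    where
    upper : ∀ a d t R → 0ℚ ≤ t → t ≤ 1ℚ → a ≤ R → a + d ≤ R → a + (1ℚ - t) * d ≤ R
    upper a d t R 0≤t t≤1 p q =
      unslack (0≤t ⊗ slack p ⊕ slack t≤1 ⊗ slack q) (solve (a ∷ d ∷ t ∷ R ∷ []) ℚ-ring)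
    top : ∀ b t R → t ≤ 1ℚ → b + 1ℚ + 1ℚ ≤ R → b + t + 1ℚ ≤ R
    top b t R t≤1 p = unslack (slack t≤1 ⊕ slack p) (solve (b ∷ t ∷ R ∷ []) ℚ-ring)

  lattice-y : ∀ {u v x y δ t} → Unit t →
              (x , y) ≡ (ι (k v) + (1ℚ - t) * ι δ , ι (s u) + t) → 0ℚ ≤ y
  lattice-y {u} (0≤t , _) refl = 0≤ι (s u) ⊕ 0≤t

  grid-box : ∀ w → Box R (ι (k w)) (ι (s w))
  grid-box w = 0≤ι (k w) , ι-mono (k≤r w) , ι-mono (s<r w)

  wrapped-end : ∀ {u v z} → copy u ≡ copy v → k u ≡ 0 → k v ≡ r → s v ≡ suc (s u) →
                Detour.Wrapped R (ι (s u)) (proj₁ (flip (copy u) z)) (proj₂ (flip (copy u) z)) →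
                Box R (proj₁ (flip (copy u) z)) (proj₂ (flip (copy u) z)) → z ≡ pos u ⊎ z ≡ pos v
  wrapped-end c≡ ku kv s≡ w b = Sum.map
    (λ eq → at-u (trans eq (sym grid-u))) (λ eq → at-v c≡ (trans eq (sym grid-v)))
    (wrapped-box w b)
    where open Turn c≡ ku kv s≡

  wrapped-y≥0 : ∀ {u v x y} → copy u ≡ copy v → k u ≡ 0 → k v ≡ r → s v ≡ suc (s u) →
                Detour.Wrapped R (ι (s u)) x y → 0ℚ ≤ y
  wrapped-y≥0 c≡ ku kv s≡ = Turn.wrapped-y c≡ ku kv s≡

  -- Seen from the copy of `u`, its own edges stay in y ≥ 0, those of the other copy in y ≤ - 1, and
  -- the jumps cross the strip between. Most pairs of edges are separated by this alone.
  upper : ∀ {u v z} → copy u ≡ copy v → Curve u v z → 0ℚ ≤ proj₂ z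
  upper {u} {v} c≡ (lattice δ t _ _ _ _ un eq)      = lattice-y {u} {v} {δ = δ} un eq
  upper         c≡ (wrapped c≡′ ku kv s≡ w)         = wrapped-y≥0 c≡′ ku kv s≡ w
  upper         c≡ (jumped _ c≢ _ _ _ _ _ _)        = contradiction c≡ c≢

  jump-start : ∀ {u v z} → copy u ≢ copy v → Curve u v (flip (copy u) z) →
               0ℚ ≤ proj₂ (flip (copy u) z) → z ≡ pos u
  jump-start c≢ (lattice _ _ c≡ _ _ _ _ _) _ = contradiction c≡ c≢
  jump-start c≢ (wrapped c≡ _ _ _ _) _ = contradiction c≡ c≢
  jump-start c≢ (jumped t _ su _ _ _ (0≤t , _) eq) p =
    jumped-0 su eq (t≡0 0≤t (subst (0ℚ ≤_) (cong proj₂ eq) p))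

  jump-finish : ∀ {u v z y} → copy u ≢ copy v → Curve u v (flip (copy u) z) →
                proj₂ (flip (copy u) z) ≡ - 1ℚ - y → 0ℚ ≤ y → z ≡ pos v
  jump-finish c≢ (lattice _ _ c≡ _ _ _ _ _) _ _ = contradiction c≡ c≢
  jump-finish c≢ (wrapped c≡ _ _ _ _) _ _ = contradiction c≡ c≢
  jump-finish {y = y} c≢ (jumped t _ su _ sv kv (_ , t≤1) eq) y≡ 0≤y =
    jumped-1 c≢ sv kv eq (≤-antisym t≤1 (late t y (trans (sym (cong proj₂ eq)) y≡) 0≤y))
    where
    late : ∀ t y → - t ≡ - 1ℚ - y → 0ℚ ≤ y → 1ℚ ≤ t
    late t y eq p = unslack (p ⊕ gap eq) (solve (t ∷ y ∷ []) ℚ-ring)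

  -- A lattice edge has integral height only at its ends, a detour meets the box of the grid only at
  -- its ends, and the interior of a jump lies in the open strip that contains no vertex.
  touch : ∀ {u v w} → Curve u v (flip (copy u) (pos w)) → pos w ≡ pos u ⊎ pos w ≡ pos v
  touch {u} {v} {w} γ with copy u Fin.≟ copy w | copy u Fin.≟ copy v
  touch {u} {v} {w} γ@(lattice δ t c≡ k≡ _ s≡ un eq) | yes cw | yes _ = Sum.map
    (lattice-0 {u} {v} {δ = δ} k≡ eq) (lattice-1 {u} {v} {δ = δ} c≡ s≡ eq)
    (integral (s w) (s u) un (cong proj₂ (trans (sym (view-same {u} {w} cw)) eq)))
  touch {u} {v} {w} (wrapped c≡ ku kv s≡ wr) | yes cw | yes _ =
    wrapped-end c≡ ku kv s≡ wr
      (subst (λ p → Box R (proj₁ p) (proj₂ p)) (sym (view-same {u} {w} cw)) (grid-box w))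
  touch (jumped _ c≢ _ _ _ _ _ _) | _ | yes c≡ = contradiction c≡ c≢
  touch {u} {v} {w} γ | yes cw | no c≢ =
    inj₁ (jump-start c≢ γ (subst (λ p → 0ℚ ≤ proj₂ p) (sym (view-same {u} {w} cw)) (0≤ι (s w))))
  touch {u} {v} {w} γ | no cw | yes c≡ =
    ⊥-elim (below (0≤ι (s w)) (subst (λ p → 0ℚ ≤ proj₂ p) (view-other {u} {w} cw) (upper c≡ γ)))
  touch {u} {v} {w} γ | no cw | no c≢ =
    inj₂ (jump-finish c≢ γ (cong proj₂ (view-other {u} {w} cw)) (0≤ι (s w)))

  -- Common points of two edges

  Vertex : Point → Set
  Vertex z = ∃[ w ] z ≡ pos w

  vertices : ∀ {u v z} → z ≡ pos u ⊎ z ≡ pos v → Vertex z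
  vertices (inj₁ eq) = _ , eq
  vertices (inj₂ eq) = _ , eq

  earlier : ∀ {u u′ y t t′} → s u ℕ.< s u′ → t ≤ 1ℚ → 0ℚ ≤ t′ →
            y ≡ ι (s u) + t → y ≡ ι (s u′) + t′ → t ≡ 1ℚ
  earlier {u} {u′} {y} {t} {t′} lt t≤1 0≤t′ p q =
    ≤-antisym t≤1 (late (ι (s u)) (ι (s u′)) t t′ (trans (sym p) q) (ι-mono lt) 0≤t′)
    where
    late : ∀ a a′ t t′ → a + t ≡ a′ + t′ → a + 1ℚ ≤ a′ → 0ℚ ≤ t′ → 1ℚ ≤ t
    late a a′ t t′ eq p q = unslack (slack p ⊕ q ⊕ gap˘ eq) (solve (a ∷ a′ ∷ t ∷ t′ ∷ []) ℚ-ring)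

  complement : ∀ {t} → Unit t → Unit (1ℚ - t)
  complement {t} (0≤t , t≤1) = slack t≤1 , unslack 0≤t (solve (t ∷ []) ℚ-ring)

  complement-0 : ∀ {t} → 1ℚ - t ≡ 0ℚ → t ≡ 1ℚ
  complement-0 {t} eq = shift (sym eq) (solve (t ∷ []) ℚ-ring)

  complement-1 : ∀ {t} → 1ℚ - t ≡ 1ℚ → t ≡ 0ℚ
  complement-1 {t} eq = shift (sym eq) (solve (t ∷ []) ℚ-ring)

  same-slope : ∀ {u v u′ v′} δ {t} → copy u ≡ copy u′ → copy u ≡ copy v → copy u′ ≡ copy v′ →
               s u ≡ s u′ → s v ≡ suc (s u) → s v′ ≡ suc (s u′) →
               k u ≡ δ ℕ.+ k v → k u′ ≡ δ ℕ.+ k v′ →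
               ι (k v) + (1ℚ - t) * ι δ ≡ ι (k v′) + (1ℚ - t) * ι δ → (u , v) ≡ (u′ , v′)
  same-slope {u} {v} {u′} {v′} δ {t} cc c≡ c≡′ ss s≡ s≡′ k≡ k≡′ eq = cong₂ _,_
    (ext cc (trans k≡ (trans (cong (δ ℕ.+_) kk) (sym k≡′))) ss)
    (ext (trans (sym c≡) (trans cc c≡′)) kk (trans s≡ (trans (cong suc ss) (sym s≡′))))
    where
    cancel : ∀ a a′ e → a + e ≡ a′ + e → a ≡ a′
    cancel a a′ e eq = shift eq (solve (a ∷ a′ ∷ e ∷ []) ℚ-ring)
    kk : k v ≡ k v′
    kk = ι-injective (cancel (ι (k v)) (ι (k v′)) _ eq)

  cross-slope : ∀ {i j t} → Unit t → ι i + (1ℚ - t) * ι 0 ≡ ι j + (1ℚ - t) * ι 1 → t ≡ 0ℚ ⊎ t ≡ 1ℚ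
  cross-slope {i} {j} {t} un eq = Sum.swap (Sum.map complement-0 complement-1
    (integral i j (complement un) (trans (sym (drop₀ (ι i) t)) (trans eq (drop₁ (ι j) t)))))
    where
    drop₀ : ∀ a t → a + (1ℚ - t) * 0ℚ ≡ a
    drop₀ = solve-∀ ℚ-ring
    drop₁ : ∀ a t → a + (1ℚ - t) * (0ℚ + 1ℚ) ≡ a + (1ℚ - t)
    drop₁ = solve-∀ ℚ-ring

  -- At height - t, two edges of one fan are (1 - t)(K′ - K) apart.
  jumps-apart : ∀ {K K′ t} → Unit t → K + 1ℚ ≤ K′ →
                R - (1ℚ - t) * (R - K) ≡ R - (1ℚ - t) * (R - K′) → t ≡ 1ℚ
  jumps-apart {K} {K′} {t} (_ , t≤1) p eq = ≤-antisym t≤1 (late R K K′ t t≤1 p eq)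
    where
    late : ∀ R K K′ t → t ≤ 1ℚ → K + 1ℚ ≤ K′ → R - (1ℚ - t) * (R - K) ≡ R - (1ℚ - t) * (R - K′) → 1ℚ ≤ t
    late R K K′ t t≤1 p eq = unslack (slack t≤1 ⊗ slack p ⊕ gap˘ eq) (solve (R ∷ K ∷ K′ ∷ t ∷ []) ℚ-ring)

  -- Two edges between the same rows, compared at the same height: parallel ones that meet coincide,
  -- while a vertical and a diagonal one differ horizontally by 1 - t plus an integer, so that t is
  -- 0 or 1.
  meet-level : ∀ {u v u′ v′ z t} → copy u ≡ copy u′ → s u ≡ s u′ → (u , v) ≢ (u′ , v′) →
    copy u ≡ copy v → copy u′ ≡ copy v′ → s v ≡ suc (s u) → s v′ ≡ suc (s u′) → Unit t →
    ∀ δ δ′ → δ ℕ.≤ 1 → δ′ ℕ.≤ 1 → k u ≡ δ ℕ.+ k v → k u′ ≡ δ′ ℕ.+ k v′ →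
    flip (copy u) z ≡ (ι (k v) + (1ℚ - t) * ι δ , ι (s u) + t) →
    flip (copy u′) z ≡ (ι (k v′) + (1ℚ - t) * ι δ′ , ι (s u′) + t) → Vertex z
  meet-level {u} {v} {u′} {v′} {z} {t} cc ss uv≢ c≡ c≡′ s≡ s≡′ un = parallel
    where
    cz : flip (copy u) z ≡ flip (copy u′) z
    cz = cong (λ c → flip c z) cc

    parallel : ∀ δ δ′ → δ ℕ.≤ 1 → δ′ ℕ.≤ 1 → k u ≡ δ ℕ.+ k v → k u′ ≡ δ′ ℕ.+ k v′ →
      flip (copy u) z ≡ (ι (k v) + (1ℚ - t) * ι δ , ι (s u) + t) →
      flip (copy u′) z ≡ (ι (k v′) + (1ℚ - t) * ι δ′ , ι (s u′) + t) → Vertex z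
    parallel zero zero _ _ k≡ k≡′ eq eq′ = contradiction
      (same-slope 0 {t} cc c≡ c≡′ ss s≡ s≡′ k≡ k≡′
        (trans (sym (cong proj₁ eq)) (cong proj₁ (trans cz eq′)))) uv≢
    parallel (suc zero) (suc zero) _ _ k≡ k≡′ eq eq′ = contradiction
      (same-slope 1 {t} cc c≡ c≡′ ss s≡ s≡′ k≡ k≡′
        (trans (sym (cong proj₁ eq)) (cong proj₁ (trans cz eq′)))) uv≢
    parallel zero (suc zero) _ _ k≡ k≡′ eq eq′ = vertices (Sum.map
      (lattice-0 {u} {v} {δ = 0} k≡ eq) (lattice-1 {u} {v} {δ = 0} c≡ s≡ eq)
      (cross-slope {k v} {k v′} un (trans (sym (cong proj₁ eq)) (cong proj₁ (trans cz eq′)))))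
    parallel (suc zero) zero _ _ k≡ k≡′ eq eq′ = vertices (Sum.map
      (lattice-0 {u} {v} {δ = 1} k≡ eq) (lattice-1 {u} {v} {δ = 1} c≡ s≡ eq)
      (cross-slope {k v′} {k v} un (trans (sym (cong proj₁ eq′)) (cong proj₁ (trans (sym cz) eq)))))
    parallel (suc (suc _)) _ (s≤s ()) _
    parallel _ (suc (suc _)) _ (s≤s ())

  meet-same : ∀ {u v u′ v′ z} → copy u ≡ copy u′ → (u , v) ≢ (u′ , v′) →
              Curve u v (flip (copy u) z) → Curve u′ v′ (flip (copy u′) z) → Vertex z
  meet-same {u} {v} {u′} {v′} {z} cc uv≢ γ γ′ = go γ γ′
    where
    cz : flip (copy u) z ≡ flip (copy u′) z
    cz = cong (λ c → flip c z) cc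

    go : Curve u v (flip (copy u) z) → Curve u′ v′ (flip (copy u′) z) → Vertex z
    -- Heights are s u + t and s u′ + t′, so between different rows only the upper end of the lower
    -- edge can be shared.
    go (lattice δ t c≡ k≡ δ≤1 s≡ un eq) (lattice δ′ t′ c≡′ k≡′ δ′≤1 s≡′ un′ eq′) with ℕ.<-cmp (s u) (s u′)
    ... | tri< s<s′ _ _ = v , lattice-1 {u} {v} {δ = δ} c≡ s≡ eq
      (earlier {u} {u′} s<s′ (proj₂ un) (proj₁ un′) (cong proj₂ eq) (cong proj₂ (trans cz eq′)))
    ... | tri> _ _ s′<s = v′ , lattice-1 {u′} {v′} {δ = δ′} c≡′ s≡′ eq′
      (earlier {u′} {u} s′<s (proj₂ un′) (proj₁ un) (cong proj₂ eq′) (cong proj₂ (trans (sym cz) eq)))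
    ... | tri≈ _ ss _ = meet-level cc ss uv≢ c≡ c≡′ s≡ s≡′ un δ δ′ δ≤1 δ′≤1 k≡ k≡′ eq
      (trans eq′ (cong (λ t → ι (k v′) + (1ℚ - t) * ι δ′ , ι (s u′) + t) (sym t≡t′)))
      where
      cancel : ∀ a t t′ → a + t ≡ a + t′ → t ≡ t′
      cancel a t t′ eq = shift eq (solve (a ∷ t ∷ t′ ∷ []) ℚ-ring)
      t≡t′ : t ≡ t′
      t≡t′ = cancel (ι (s u)) t t′ (trans (sym (cong proj₂ eq))
        (trans (cong proj₂ (trans cz eq′)) (cong (λ i → ι i + t′) (sym ss))))
    go (lattice δ _ _ k≡ _ s≡ un eq) (wrapped c≡′ ku kv s≡′ w) =
      vertices (wrapped-end c≡′ ku kv s≡′ w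
        (subst (λ p → Box R (proj₁ p) (proj₂ p)) cz (lattice-box {u} {v} {δ = δ} k≡ s≡ un eq)))
    go (wrapped c≡ ku kv s≡ w) (lattice δ′ _ _ k≡′ _ s≡′ un′ eq′) =
      vertices (wrapped-end c≡ ku kv s≡ w
        (subst (λ p → Box R (proj₁ p) (proj₂ p)) (sym cz)
          (lattice-box {u′} {v′} {δ = δ′} k≡′ s≡′ un′ eq′)))
    -- A point determines the S of the detour through it, and S determines the edge within its copy.
    go (wrapped c≡ ku kv s≡ w) (wrapped c≡′ ku′ kv′ s≡′ w′) =
      contradiction (cong₂ _,_
        (ext cc (trans ku (sym ku′)) ss)
        (ext (trans (sym c≡) (trans cc c≡′)) (trans kv (sym kv′))
          (trans s≡ (trans (cong suc ss) (sym s≡′))))) uv≢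
      where
      S≡S′ : Detour.Wrapped R (ι (s u)) (proj₁ (flip (copy u) z)) (proj₂ (flip (copy u) z)) →
             Detour.Wrapped R (ι (s u′)) (proj₁ (flip (copy u) z)) (proj₂ (flip (copy u) z)) →
             ι (s u) ≡ ι (s u′)
      S≡S′ (inj₁ (l , p)) (inj₁ (l′ , p′)) = ≤-antisym (legs-≤ p′ l) (legs-≤ p l′)
      S≡S′ (inj₁ (l , p)) (inj₂ τ′) = sym (tail-side (0≤ι (s u′)) (S+2≤R {u′} {v′} s≡′) τ′ p)
      S≡S′ (inj₂ τ) (inj₁ (l′ , p′)) = tail-side (0≤ι (s u)) (S+2≤R {u} {v} s≡) τ p′
      S≡S′ (inj₂ τ) (inj₂ τ′) = tails-≡ τ τ′
      ss : s u ≡ s u′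
      ss = ι-injective (S≡S′ w
        (subst (λ p → Detour.Wrapped R (ι (s u′)) (proj₁ p) (proj₂ p)) (sym cz) w′))
    go (jumped t c≢ su ku<r sv kv un eq) (jumped t′ c≢′ su′ ku′<r sv′ kv′ un′ eq′) with ℕ.<-cmp (k u) (k u′)
    ... | tri≈ _ kk _ = contradiction (cong₂ _,_ (ext cc kk (trans su (sym su′)))
      (ext (≢-≢⇒≡ (c≢ ∘ sym) (subst (_≢ copy v′) (sym cc) c≢′))
        (trans kv (sym kv′)) (trans sv (sym sv′)))) uv≢
    ... | tri< k<k′ _ _ = v , jumped-1 c≢ sv kv eq (jumps-apart {ι (k u)} {ι (k u′)} un (ι-mono k<k′)
      (trans (sym (cong proj₁ eq)) (trans (cong proj₁ (trans cz eq′))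
        (cong (λ t → R - (1ℚ - t) * (R - ι (k u′))) (sym tt)))))
      where
      tt : t ≡ t′
      tt = neg-injective (trans (sym (cong proj₂ eq)) (cong proj₂ (trans cz eq′)))
    ... | tri> _ _ k′<k = v , jumped-1 c≢ sv kv eq (jumps-apart {ι (k u′)} {ι (k u)} un (ι-mono k′<k)
      (sym (trans (sym (cong proj₁ eq)) (trans (cong proj₁ (trans cz eq′))
        (cong (λ t → R - (1ℚ - t) * (R - ι (k u′))) (sym tt))))))
      where
      tt : t ≡ t′
      tt = neg-injective (trans (sym (cong proj₂ eq)) (cong proj₂ (trans cz eq′)))
    go γ@(lattice _ _ c≡ _ _ _ _ _) γ′@(jumped _ c≢′ _ _ _ _ _ _) =
      u′ , jump-start c≢′ γ′ (subst (λ p → 0ℚ ≤ proj₂ p) cz (upper c≡ γ))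
    go γ@(wrapped c≡ _ _ _ _) γ′@(jumped _ c≢′ _ _ _ _ _ _) =
      u′ , jump-start c≢′ γ′ (subst (λ p → 0ℚ ≤ proj₂ p) cz (upper c≡ γ))
    go γ@(jumped _ c≢ _ _ _ _ _ _) γ′@(lattice _ _ c≡′ _ _ _ _ _) =
      u , jump-start c≢ γ (subst (λ p → 0ℚ ≤ proj₂ p) (sym cz) (upper c≡′ γ′))
    go γ@(jumped _ c≢ _ _ _ _ _ _) γ′@(wrapped c≡′ _ _ _ _) =
      u , jump-start c≢ γ (subst (λ p → 0ℚ ≤ proj₂ p) (sym cz) (upper c≡′ γ′))

  opposite : ∀ {u u′ z} → copy u ≢ copy u′ →
             flip (copy u′) z ≡ (R + R - proj₁ (flip (copy u) z) , - 1ℚ - proj₂ (flip (copy u) z))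
  opposite {u} {u′} {z} c≢ = trans (cong (flip (copy u′)) (sym (flip-involutive (copy u) z)))
    (flip-other (c≢ ∘ sym) _ _)

  -- The two fans lie on opposite sides of the line x = R, which each edge reaches only at its end.
  jumps-opposed : ∀ {K K′ t t′} → Unit t → Unit t′ → K + 1ℚ ≤ R → K′ + 1ℚ ≤ R →
    R - (1ℚ - t′) * (R - K′) ≡ R + R - (R - (1ℚ - t) * (R - K)) → t ≡ 1ℚ
  jumps-opposed {K} {K′} {t} {t′} (_ , t≤1) (_ , t′≤1) p p′ eq =
    ≤-antisym t≤1 (late R K K′ t t′ t≤1 t′≤1 p p′ eq)
    where
    late : ∀ R K K′ t t′ → t ≤ 1ℚ → t′ ≤ 1ℚ → K + 1ℚ ≤ R → K′ + 1ℚ ≤ R →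
      R - (1ℚ - t′) * (R - K′) ≡ R + R - (R - (1ℚ - t) * (R - K)) → 1ℚ ≤ t
    late R K K′ t t′ t≤1 t′≤1 p p′ eq = unslack
      (slack t≤1 ⊗ slack p ⊕ slack t′≤1 ⊗ (slack p′ ⊕ 0≤1) ⊕ gap˘ eq)
      (solve (R ∷ K ∷ K′ ∷ t ∷ t′ ∷ []) ℚ-ring)

  meet-other : ∀ {u v u′ v′ z} → copy u ≢ copy u′ →
               Curve u v (flip (copy u) z) → Curve u′ v′ (flip (copy u′) z) → Vertex z
  meet-other {u} {v} {u′} {v′} {z} cc γ γ′ with copy u Fin.≟ copy v | copy u′ Fin.≟ copy v′
  ... | yes c≡ | yes c≡′ = ⊥-elim (below (upper c≡ γ)
    (subst (λ p → 0ℚ ≤ proj₂ p) (opposite {u} {u′} {z} cc) (upper c≡′ γ′)))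
  ... | yes c≡ | no c≢′ = v′ , jump-finish c≢′ γ′ (cong proj₂ (opposite {u} {u′} {z} cc)) (upper c≡ γ)
  ... | no c≢ | yes c≡′ = v , jump-finish c≢ γ (cong proj₂ (opposite {u′} {u} {z} (cc ∘ sym))) (upper c≡′ γ′)
  meet-other {u} {v} {u′} {v′} {z} cc (jumped t c≢ su ku sv kv un eq)
    (jumped t′ c≢′ su′ ku′ sv′ kv′ un′ eq′)
    | no _ | no _ = v , jumped-1 c≢ sv kv eq
      (jumps-opposed {ι (k u)} {ι (k u′)} un un′ (ι-mono ku) (ι-mono ku′)
        (trans (sym (cong proj₁ eq′)) (trans (cong proj₁ (opposite {u} {u′} {z} cc))
          (cong (λ p → R + R - proj₁ p) eq))))
  meet-other _ (lattice _ _ c≡ _ _ _ _ _) _ | no c≢ | no _ = contradiction c≡ c≢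
  meet-other _ (wrapped c≡ _ _ _ _) _ | no c≢ | no _ = contradiction c≡ c≢
  meet-other _ (jumped _ _ _ _ _ _ _ _) (lattice _ _ c≡ _ _ _ _ _) | no _ | no c≢ = contradiction c≡ c≢
  meet-other _ (jumped _ _ _ _ _ _ _ _) (wrapped c≡ _ _ _ _) | no _ | no c≢ = contradiction c≡ c≢

  edge-step : ∀ {u v} → u Fin.< v → Graph.Adj (coverGraph arcPoset) u v → Step u v
  edge-step u<v (inj₁ cover) = step cover
  edge-step u<v (inj₂ cover) = contradiction (step⇒< (step cover)) (Fin.<-asym u<v)

  planar : Planar (coverGraph arcPoset)
  planar = record
    { pos = pos
    ; pos-injective = pos-injective
    ; arc = arc
    ; arc-simple = λ (u<v , adj) → simple′ (wraps? _ _) (edge-step u<v adj)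
    ; arc-vertices = λ (u<v , adj) w on → Sum.map pos-injective pos-injective
        (touch (curve (edge-step u<v adj) on))
    ; arcs-meet = λ {u} {v} {u′} {v′} (u<v , adj) (u′<v′ , adj′) uv≢ z on on′ →
        meet (copy u Fin.≟ copy u′) uv≢
          (curve (edge-step u<v adj) on) (curve (edge-step u′<v′ adj′) on′)
    }
    where
    meet : ∀ {u v u′ v′ z} → Dec (copy u ≡ copy u′) → (u , v) ≢ (u′ , v′) →
           Curve u v (flip (copy u) z) → Curve u′ v′ (flip (copy u′) z) → Vertex z
    meet (yes cc) = meet-same cc
    meet (no  cc) _ = meet-other cc

-- The case of height one

onePoint : FinPoset
onePoint = record
  { size = 1
  ; _⊑_  = _≡_
  ; isDecPartialOrder = record
    { isPartialOrder = record
      { isPreorder = record { isEquivalence = isEquivalence ; reflexive = id ; trans = trans }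
      ; antisym    = λ p _ → p
      }
    ; _≟_  = Fin._≟_
    ; _≤?_ = Fin._≟_
    }
  }

onePoint-height : HasHeight onePoint 1
onePoint-height = hasHeight onePoint id (λ p _ → p) id id λ { {zero} {zero} _ → refl }

onePoint-planar : Planar (coverGraph onePoint)
onePoint-planar = record
  { pos           = λ _ → 0ℚ , 0ℚ
  ; pos-injective = λ { {zero} {zero} _ → refl }
  ; arc           = λ _ _ → segment _ _
  ; arc-simple    = λ { {zero} {zero} (() , _) }
  ; arc-vertices  = λ { {zero} {zero} (() , _) }
  ; arcs-meet     = λ { {zero} {zero} (() , _) }
  }

open import Data.Nat.Base using (_≤_; _*_; _∸_)

theorem3 : ∀ (h : ℕ) → 1 ≤ h →
    Σ[ P ∈ FinPoset ]
    ( HasHeight P h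
    × Planar (coverGraph P)
    × ∃[ d ] (HasDimension P d × 2 * h ∸ 2 ≤ d) )
-- For r = 0 the poset of arcs is empty, so this height needs a poset of its own; the bound on the
-- dimension is 0.
theorem3 (suc zero) _ =
  onePoint , onePoint-height , onePoint-planar ,
  (let d , dim = Dimension.hasDimension onePoint in d , dim , z≤n)
theorem3 (suc (suc m)) _ =
  arcPoset , height , Drawing.planar r ,
  (let d , dim , 2r≤d = dimension
   in d , dim , subst (_≤ d) (sym (cong (_∸ 2) (ℕ.*-suc 2 r))) 2r≤d)
  where
  r : ℕ
  r = suc m
  open Arcs r
  open Nonempty {m} refl
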